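{- Let $K$ be a field of characteristic zero, and let $I$ be an Artinian ideal in $R = K[x,y,z]$ generated by monomials whose degrees are bounded above by $d$. Let $T = T_d(I)$. If $T$ is non-empty, then any two of the following conditions imply the third: (i) $I$ is perfectly-punctured (in degree $d$); (ii) $T$ is tileable; (iii) the syzygy bundle $\widetilde{\operatorname{syz} I}$ on $\mathbb{P}^2$ is semistable.
   Context: For $d\ge 1$, $\mathcal{T}_d$ is the equilateral triangle of side length $d$ subdivided into equilateral unit triangles. Its downward-pointing unit triangles are labelled bijectively by the monomials of degree $d-2$ in $x,y,z$, and its upward-pointing unit triangles by the monomials of degree $d-1$, with $x^{d-1}$ at the top, $y^{d-1}$ at the bottom-left, $z^{d-1}$ at the bottom-right; a downward-pointing triangle with label $n$ and an upward-pointing triangle with label $m$ share an edge if and only if $m\in\{xn,yn,zn\}$. For a monomial ideal $I$, the region $T_d(I)$ is the set of unit triangles of $\mathcal{T}_d$ whose label is not in $I$. A lozenge is the union of two unit triangles sharing an edge. A region is tileable if it is empty or can be partitioned into lozenges. If $g_1,\dots,g_m$ are the minimal monomial generators of $I$, all of degree at most $d$, the over-puncturing coefficient of $I$ in degree $d$ is $\mathfrak{o}_d(I)=\sum_{i=1}^m (d-\deg g_i) - d$; $I$ is perfectly-punctured in degree $d$ if $\mathfrak{o}_d(I)=0$. The syzygy module $\operatorname{syz} I$ is the kernel of the surjection $\bigoplus_{i=1}^m R(-\deg g_i)\to I$ given by the minimal generators, and the syzygy bundle $\widetilde{\operatorname{syz} I}$ is its sheafification, a vector bundle of rank $m-1$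 on $\mathbb{P}^2$. A vector bundle $E$ is semistable if $\mu(F)\le\mu(E)$ for every non-zero coherent subsheaf $F\subset E$, where $\mu=c_1/\operatorname{rk}$. (By a theorem of Brenner, for monomial ideals in characteristic zero this is equivalent to: for every proper subset $J\subset\{1,\dots,m\}$ with at least two elements, $\frac{d_J-\sum_{j\in J}\deg g_j}{|J|-1}\le\frac{ -\sum_{i=1}^m\deg g_i}{m-1}$, where $d_J$ is the degree of $\gcd\{g_j: j\in J\}$; this may be taken as the definition of semistability.) -}

module Defs where

open import Level using (0ℓ)
open import Data.Bool using (if_then_else_)
open import Data.Fin using (Fin)
open import Data.Fin.Subset using (Subset; ⊤; ∣_∣; _⊂_) renaming (_∈_ to _∈ˢ_)
open import Data.Fin.Subset.Properties using (∣p∣≤n)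
open import Data.Integer using (ℤ; +_; 0ℤ; -_; _-_)
open import Data.Integer.Properties using (+-0-commutativeMonoid)
open import Data.List using (List)
open import Data.List.Membership.Propositional using () renaming (_∈_ to _∈ˡ_)
open import Data.List.Relation.Unary.All using (All)
open import Data.List.Relation.Unary.AllPairs using (AllPairs)
open import Data.List.Relation.Unary.Any using (Any)
open import Data.Nat using (ℕ; suc; _+_; _∸_; _≤_; >-nonZero)
open import Data.Nat.Properties using (m<n⇒0<n∸m; ≤-trans)
open import Data.Product using (∃; _×_)
open import Data.Rational using (ℚ; _/_) renaming (_≤_ to _≤ℚ_)
open import Data.Sum using (_⊎_)
open import Data.Vec using (Vec; sum; updateAt; lookup)
open import Data.Vec.Relation.Binary.Pointwise.Inductive using (Pointwise)
open import Relation.Binary.PropositionalEquality using (_≡_; _≢_)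
open import Relation.Nullary using (¬_)
open import Relation.Unary using (Pred; _∈_; _∉_; _⊆_; _⊥_; Empty)

open import Algebra.Properties.CommutativeMonoid.Sum +-0-commutativeMonoid
  using (sum-syntax)

-- Exponent vectors in the variables x, y, z.

Monomial : Set
Monomial = Vec ℕ 3

deg : Monomial → ℕ
deg = sum

infix 4 _∣_
_∣_ : Monomial → Monomial → Set
_∣_ = Pointwise _≤_

infixr 7 X_·_
X_·_ : Fin 3 → Monomial → Monomial
X i · n = updateAt n i suc

-- A monomial ideal is given by its minimal monomial generators, which
-- determine it and are determined by it.  The ideal enters everything below
-- only through the monomials it contains, so no coefficient field appears.
record MonomialIdeal : Set where
  field
    m       : ℕ
    gen     : Fin m → Monomial
    minimal : ∀ {i j} → i ≢ j → ¬ (gen i ∣ gen j)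

open MonomialIdeal public

⟨_⟩ : MonomialIdeal → Pred Monomial 0ℓ
⟨ I ⟩ n = ∃ λ i → gen I i ∣ n

-- R/I has finite length: the monomials outside I, which form a vector space
-- basis of R/I, are finitely many.
Artinian : MonomialIdeal → Set
Artinian I = ∃ λ (ns : List Monomial) → ∀ {n} → n ∉ ⟨ I ⟩ → n ∈ˡ ns

data Triangle : Set where
  ▽ △ : Monomial → Triangle

label : Triangle → Monomial
label (▽ n) = n
label (△ n) = n

Region : Set₁
Region = Pred Triangle 0ℓ

-- Labels have degree d - 2 (▽) and d - 1 (△).  The equations avoid truncated
-- subtraction, so that for d = 1 there is no downward-pointing triangle.
𝒯 : ℕ → Region
𝒯 d (▽ n) = 2 + deg n ≡ d
𝒯 d (△ n) = 1 + deg n ≡ d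

T : ℕ → MonomialIdeal → Region
T d I t = t ∈ 𝒯 d × label t ∉ ⟨ I ⟩

record Lozenge : Set where
  constructor lozenge
  field
    down up    : Monomial
    sharesEdge : ∃ λ i → up ≡ X i · down

⟦_⟧ : Lozenge → Region
⟦ ℓ ⟧ t = t ≡ ▽ (Lozenge.down ℓ) ⊎ t ≡ △ (Lozenge.up ℓ)

record IsPartition (U : Region) (ℓs : List Lozenge) : Set where
  field
    inside   : All (λ ℓ → ⟦ ℓ ⟧ ⊆ U) ℓs
    covering : ∀ {t} → t ∈ U → Any (λ ℓ → t ∈ ⟦ ℓ ⟧) ℓs
    disjoint : AllPairs (λ ℓ ℓ′ → ⟦ ℓ ⟧ ⊥ ⟦ ℓ′ ⟧) ℓs

Tileable : Region → Set
Tileable U = Empty U ⊎ ∃ (IsPartition U)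

overPuncturing : ℕ → MonomialIdeal → ℤ
overPuncturing d I = (∑[ i < m I ] (+ d - + deg (gen I i))) - + d

PerfectlyPunctured : ℕ → MonomialIdeal → Set
PerfectlyPunctured d I = overPuncturing d I ≡ 0ℤ

record IsGCD (I : MonomialIdeal) (J : Subset (m I)) (h : Monomial) : Set where
  field
    commonDivisor : ∀ {j} → j ∈ˢ J → h ∣ gen I j
    greatest      : ∀ {h′} → (∀ {j} → j ∈ˢ J → h′ ∣ gen I j) → h′ ∣ h

degSum : (I : MonomialIdeal) → Subset (m I) → ℤ
degSum I J = ∑[ j < m I ] (if lookup J j then + deg (gen I j) else 0ℤ)

-- c / (k - 1)
_/pred_ : ℤ → ∀ {k} → 2 ≤ k → ℚ
_/pred_ c {k} 2≤k = _/_ c (k ∸ 1) {{>-nonZero (m<n⇒0<n∸m 2≤k)}}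

-- Semistability of the syzygy bundle of I, by Brenner's criterion for monomial
-- ideals in characteristic zero.  The right-hand side is the slope of the
-- bundle, which has rank m - 1 and first Chern class - ∑ deg gᵢ.
SyzygyBundleSemistable : MonomialIdeal → Set
SyzygyBundleSemistable I =
  ∀ (J : Subset (m I)) → J ⊂ ⊤ → (2≤∣J∣ : 2 ≤ ∣ J ∣) →
  ∀ (h : Monomial) → IsGCD I J h →
  ((+ deg h - degSum I J) /pred 2≤∣J∣)
    ≤ℚ ((- (∑[ i < m I ] (+ deg (gen I i)))) /pred ≤-trans 2≤∣J∣ (∣p∣≤n J))

{-# OPTIONS --safe #-}

-- Let d = n + 1, let puncture i have side sᵢ = d - deg gᵢ, and let S = ∑ sᵢ, so that I is perfectly punctured
-- if and only if S = d.  A triangle of side s has s more upward- than downward-pointing unit triangles.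
-- Hence a tiling gives S = d + o, where o counts the overlaps of the punctures, and overlaps can only vanish
-- in total if there are none.
--
-- Given a tiling and S = d, the punctures do not overlap, and no triangle formed by the multiples of h has
-- more downward- than upward-pointing triangles outside I.  This says that ∑_{j ∈ J} sⱼ ≤ d - deg h, which is
-- the slope inequality for S = d.
--
-- Conversely, merge the unit triangles of a set W of upward-pointing triangles, enlarging two triangles with
-- a common vertex to the smallest triangle containing both, until all are apart.  The total side of the result
-- is at most |W| minus the number of downward-pointing triangles with all three neighbours in W.  If W contains
-- the punctures, the slope inequalities bound this total side from below by S = d.  For the union W of the
-- punctures and the neighbours of a set of downward-pointing triangles this is Hall's condition.
--
-- Finally, assume semistability, a tiling, and o > 0.  From any lozenge, two paths in the tiling lead to
-- different edges and cut one corner of the triangle off from the others.  Merging separately on the two sides of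
-- the cut yields at least two triangles of total side at most d, whereas the slope inequalities force this total
-- above d unless there is only one.

module Submission where

open import Defs
open import Data.Bool using (true; false; if_then_else_)
open import Data.Empty using (⊥)
open import Data.Fin using (Fin; zero; suc)
open import Data.Fin.Patterns using (0F; 1F; 2F)
import Data.Fin.Properties as Fin
open import Data.Fin.Subset using (Subset; ⊤; ∣_∣; _⊂_) renaming (_∈_ to _∈ˢ_)
open import Data.Fin.Subset.Properties using (∣p∣≤n; ∈⊤; _∈?_)
open import Data.Integer as ℤ using (ℤ; 0ℤ)
import Data.Integer.Properties as ℤ
open import Algebra.Properties.CommutativeMonoid.Sum ℤ.+-0-commutativeMonoid using (sum-syntax; sum-cong-≗)
open import Data.Integer.Tactic.RingSolver using () renaming (solve-∀ to ℤ-solve-∀)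
open import Data.List using (List; []; _∷_; _++_; map; filter; length; tabulate; allFin)
open import Data.List.Membership.Propositional using (_∈_; find; lose)
open import Data.List.Membership.Propositional.Properties
open import Data.List.Properties using (map-tabulate; length-map; length-++; length-tabulate)
open import Data.List.Relation.Binary.Permutation.Propositional using (_↭_; ↭-refl; ↭-sym; ↭-trans; ↭-prep; ↭⇒↭ₛ)
open import Data.List.Relation.Binary.Permutation.Propositional.Properties using (All-resp-↭; ∈-resp-↭; ↭-length; shift) renaming (map⁺ to ↭-map⁺)
import Data.List.Relation.Binary.Permutation.Setoid.Properties as Permutation
open import Data.List.Relation.Unary.All as All using (All; []; _∷_)
import Data.List.Relation.Unary.All.Properties as All
open import Data.List.Relation.Unary.AllPairs as AllPairs using (AllPairs; []; _∷_)
import Data.List.Relation.Unary.AllPairs.Properties as AllPairs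
open import Data.List.Relation.Unary.Any as Any using (Any; here; there)
open import Data.List.Relation.Unary.Unique.Propositional using (Unique)
import Data.List.Relation.Unary.Unique.Propositional.Properties as Unique
open import Data.Nat using (ℕ; zero; suc; _+_; _*_; _∸_; _⊓_; _⊔_; _≤_; _<_; z≤n; s≤s; s≤s⁻¹; _≤?_; _<?_; >-nonZero; NonZero)
open import Data.Nat.Properties hiding (_≟_)
import Data.Nat.Properties as ℕ
open import Data.Nat.Tactic.RingSolver using (solve-∀)
open import Data.Product using (∃; ∃₂; _×_; _,_; proj₁; proj₂)
open import Data.Rational using () renaming (_≤_ to _≤ℚ_; _/_ to _/ℚ_)
import Data.Rational.Properties as ℚ
import Data.Rational.Unnormalised as ℚᵘ
import Data.Rational.Unnormalised.Properties as ℚᵘ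
open import Data.Sum using (_⊎_; inj₁; inj₂; [_,_]′)
open import Data.Vec as Vec using (Vec; []; _∷_; lookup; updateAt)
import Data.Vec.Properties as Vec
open import Data.Vec.Relation.Binary.Pointwise.Inductive as Pointwise using (Pointwise; []; _∷_)
open import Function using (_∘_; id)
open import Relation.Binary.PropositionalEquality using (setoid; _≡_; _≢_; refl; sym; ≢-sym; trans; cong; cong₂; subst; subst₂; module ≡-Reasoning)
open import Relation.Nullary using (¬_; Dec; yes; no; does; contradiction; ¬?)
open import Relation.Nullary.Decidable using (_×-dec_; _⊎-dec_; dec-true)
open import Relation.Unary using (Pred; Decidable; Satisfiable)

-- Finite sums and counting

private
  variable
    A B : Set

Σ : List A → (A → ℕ) → ℕ
Σ []       f = 0
Σ (x ∷ xs) f = f x + Σ xs f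

Σ-mono : (xs : List A) {f g : A → ℕ} → (∀ {x} → x ∈ xs → f x ≤ g x) → Σ xs f ≤ Σ xs g
Σ-mono []       f≤g = z≤n
Σ-mono (x ∷ xs) f≤g = +-mono-≤ (f≤g (here refl)) (Σ-mono xs (f≤g ∘ there))

Σ-cong : (xs : List A) {f g : A → ℕ} → (∀ {x} → x ∈ xs → f x ≡ g x) → Σ xs f ≡ Σ xs g
Σ-cong []       f≡g = refl
Σ-cong (x ∷ xs) f≡g = cong₂ _+_ (f≡g (here refl)) (Σ-cong xs (f≡g ∘ there))

Σ-mono-at : (xs : List A) {f g : A → ℕ} {x : A} {c : ℕ} → (∀ {y} → y ∈ xs → f y ≤ g y) →
  x ∈ xs → f x + c ≤ g x → Σ xs f + c ≤ Σ xs g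
Σ-mono-at (x ∷ xs) {f} {g} {c = c} f≤g (here refl) gap = begin
  f x + Σ xs f + c  ≡⟨ rearrange (f x) (Σ xs f) c ⟩
  f x + c + Σ xs f  ≤⟨ +-mono-≤ gap (Σ-mono xs (f≤g ∘ there)) ⟩
  g x + Σ xs g      ∎
  where
  open ≤-Reasoning
  rearrange : ∀ a b e → a + b + e ≡ a + e + b
  rearrange = solve-∀
Σ-mono-at (y ∷ xs) {f} {c = c} f≤g (there x∈xs) gap =
  ≤-trans (≤-reflexive (+-assoc (f y) (Σ xs f) c))
    (+-mono-≤ (f≤g (here refl)) (Σ-mono-at xs (f≤g ∘ there) x∈xs gap))

Σ-distrib-+ : (xs : List A) (f g : A → ℕ) → Σ xs (λ x → f x + g x) ≡ Σ xs f + Σ xs g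
Σ-distrib-+ []       f g = refl
Σ-distrib-+ (x ∷ xs) f g = trans (cong (_+_ (f x + g x)) (Σ-distrib-+ xs f g))
  (interchange (f x) (g x) (Σ xs f) (Σ xs g))
  where
  interchange : ∀ a b c e → a + b + (c + e) ≡ a + c + (b + e)
  interchange = solve-∀

Σ-distribʳ-* : (xs : List A) (f : A → ℕ) (k : ℕ) → Σ xs (λ x → f x * k) ≡ Σ xs f * k
Σ-distribʳ-* []       f k = refl
Σ-distribʳ-* (x ∷ xs) f k = trans (cong (_+_ (f x * k)) (Σ-distribʳ-* xs f k)) (sym (*-distribʳ-+ k (f x) _))

Σ-const : (xs : List A) (k : ℕ) → Σ xs (λ _ → k) ≡ length xs * k
Σ-const []       k = refl
Σ-const (x ∷ xs) k = cong (_+_ (k)) (Σ-const xs k)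

Σ-++ : (xs ys : List A) (f : A → ℕ) → Σ (xs ++ ys) f ≡ Σ xs f + Σ ys f
Σ-++ []       ys f = refl
Σ-++ (x ∷ xs) ys f = trans (cong (_+_ (f x)) (Σ-++ xs ys f)) (sym (+-assoc (f x) _ _))

Σ-map : (h : A → B) (xs : List A) (f : B → ℕ) → Σ (map h xs) f ≡ Σ xs (f ∘ h)
Σ-map h []       f = refl
Σ-map h (x ∷ xs) f = cong (_+_ (f (h x))) (Σ-map h xs f)

Σ-comm : (xs : List A) (ys : List B) (f : A → B → ℕ) →
  Σ xs (λ x → Σ ys (f x)) ≡ Σ ys (λ y → Σ xs (λ x → f x y))
Σ-comm []       ys f = sym (trans (Σ-const ys 0) (*-zeroʳ (length ys)))
Σ-comm (x ∷ xs) ys f = trans (cong (_+_ (Σ ys (f x))) (Σ-comm xs ys f))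
  (sym (Σ-distrib-+ ys (f x) (λ y → Σ xs (λ x → f x y))))

Σ-≡0 : (xs : List A) {f : A → ℕ} → Σ xs f ≡ 0 → ∀ {x} → x ∈ xs → f x ≡ 0
Σ-≡0 (x ∷ xs) {f} eq (here refl) = m+n≡0⇒m≡0 (f x) eq
Σ-≡0 (x ∷ xs) {f} eq (there p)   = Σ-≡0 xs (m+n≡0⇒n≡0 (f x) eq) p

Σ-≥ : (xs : List A) (f : A → ℕ) {x : A} → x ∈ xs → f x ≤ Σ xs f
Σ-≥ (x ∷ xs) f (here refl) = m≤m+n (f x) _
Σ-≥ (x ∷ xs) f (there p)   = ≤-trans (Σ-≥ xs f p) (m≤n+m _ (f x))

∑≡Σ : ∀ k (f : Fin k → ℕ) → ∑[ i < k ] (ℤ.+ f i) ≡ ℤ.+ Σ (allFin k) f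
∑≡Σ k f = go k id f
  where
  go : ∀ k {l} (g : Fin k → Fin l) (f : Fin l → ℕ) → ∑[ i < k ] (ℤ.+ f (g i)) ≡ ℤ.+ Σ (tabulate g) f
  go zero    g f = refl
  go (suc k) g f = cong (λ s → ℤ.+ f (g zero) ℤ.+ s) (go k (g ∘ suc) f)

𝟙 : {P : Set} → Dec P → ℕ
𝟙 p = if does p then 1 else 0

𝟙-mono : {P Q : Set} (p : Dec P) (q : Dec Q) → (P → Q) → 𝟙 p ≤ 𝟙 q
𝟙-mono (no _)  q       P→Q = z≤n
𝟙-mono (yes _) (yes _) P→Q = ≤-refl
𝟙-mono (yes p) (no ¬q) P→Q = contradiction (P→Q p) ¬q

𝟙-cong : {P Q : Set} (p : Dec P) (q : Dec Q) → (P → Q) → (Q → P) → 𝟙 p ≡ 𝟙 q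
𝟙-cong p q P→Q Q→P = ≤-antisym (𝟙-mono p q P→Q) (𝟙-mono q p Q→P)

𝟙-true : {P : Set} (p : Dec P) → P → 𝟙 p ≡ 1
𝟙-true (yes _) _ = refl
𝟙-true (no ¬p) p = contradiction p ¬p

𝟙-false : {P : Set} (p : Dec P) → ¬ P → 𝟙 p ≡ 0
𝟙-false (yes p) ¬p = contradiction p ¬p
𝟙-false (no _)  _  = refl

length-filter-Σ : {P : A → Set} (P? : Decidable P) (xs : List A) →
  length (filter P? xs) ≡ Σ xs (λ x → 𝟙 (P? x))
length-filter-Σ P? []       = refl
length-filter-Σ P? (x ∷ xs) with P? x
... | yes _ = cong suc (length-filter-Σ P? xs)
... | no _  = length-filter-Σ P? xs

length-filter-¬ : {P : A → Set} (P? : Decidable P) (xs : List A) →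
  length (filter P? xs) + length (filter (¬? ∘ P?) xs) ≡ length xs
length-filter-¬ P? []       = refl
length-filter-¬ P? (x ∷ xs) with P? x
... | yes _ = cong suc (length-filter-¬ P? xs)
... | no _  = trans (+-suc _ _) (cong suc (length-filter-¬ P? xs))

-- Stated for a relation so that a tiling can be used in either direction. The partner of the first
-- entry is cut out of `ys`; by injectivity no later entry is paired with it.
length-≤-by-injection : (R : A → B → Set) → (∀ {x x′ y} → R x y → R x′ y → x ≡ x′) →
  ∀ {xs ys} → Unique xs → (∀ {x} → x ∈ xs → ∃ λ y → y ∈ ys × R x y) → length xs ≤ length ys
length-≤-by-injection R inj {[]}     _          _    = z≤n
length-≤-by-injection R inj {x ∷ xs} {ys} (x∉xs ∷ xs!) into with into (here refl)
... | y , y∈ys , Rxy with ∈-∃++ y∈ys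
...   | as , bs , refl = begin
  suc (length xs)            ≤⟨ s≤s (length-≤-by-injection R inj xs! into′) ⟩
  suc (length (as ++ bs))    ≡⟨ cong suc (length-++ as) ⟩
  suc (length as + length bs) ≡⟨ +-suc (length as) (length bs) ⟨
  length as + length (y ∷ bs) ≡⟨ length-++ as ⟨
  length (as ++ y ∷ bs)      ∎
  where
  open ≤-Reasoning
  into′ : ∀ {x′} → x′ ∈ xs → ∃ λ y′ → y′ ∈ as ++ bs × R x′ y′
  into′ {x′} x′∈xs with into (there x′∈xs)
  ... | y′ , y′∈ys , Rx′y′ with ∈-++⁻ as y′∈ys
  ...   | inj₁ y′∈as          = y′ , ∈-++⁺ˡ y′∈as , Rx′y′
  ...   | inj₂ (there y′∈bs)  = y′ , ∈-++⁺ʳ as y′∈bs , Rx′y′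
  ...   | inj₂ (here refl)    = contradiction (inj Rxy Rx′y′) (All.lookup x∉xs x′∈xs)

length-≤-⊆ : {xs ys : List A} → Unique xs → (∀ {x} → x ∈ xs → x ∈ ys) → length xs ≤ length ys
length-≤-⊆ xs! xs⊆ys = length-≤-by-injection _≡_ (λ { refl refl → refl }) xs! (λ p → _ , xs⊆ys p , refl)

-- An element of `ys` missing from `xs` could be put in front of `xs`, giving a duplicate-free list
-- inside `ys` that is too long.
Unique-⊆-reverse : (_≟_ : (x y : A) → Dec (x ≡ y)) {xs ys : List A} → Unique xs →
  (∀ {x} → x ∈ xs → x ∈ ys) → length ys ≤ length xs → ∀ {y} → y ∈ ys → y ∈ xs
Unique-⊆-reverse _≟_ {xs} {ys} xs! xs⊆ys len {y} y∈ys with Any.any? (y ≟_) xs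
... | yes y∈xs = y∈xs
... | no  y∉xs = contradiction len (<⇒≱ (length-≤-⊆ (All.¬Any⇒All¬ xs y∉xs ∷ xs!) λ where
  (here refl) → y∈ys
  (there p)   → xs⊆ys p))

-- Monomials of a given degree

∣-refl : ∀ {u} → u ∣ u
∣-refl = Pointwise.refl ≤-refl

∣-trans : ∀ {u v w} → u ∣ v → v ∣ w → u ∣ w
∣-trans = Pointwise.trans ≤-trans

infix 4 _∣?_ _≟_
_∣?_ : (u v : Monomial) → Dec (u ∣ v)
_∣?_ = Pointwise.decidable _≤?_

_≟_ : (u v : Monomial) → Dec (u ≡ v)
_≟_ = Vec.≡-dec ℕ._≟_

deg-mono : ∀ {u v} → u ∣ v → deg u ≤ deg v
deg-mono (p ∷ q ∷ r ∷ []) = +-mono-≤ p (+-mono-≤ q (+-mono-≤ r z≤n))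

deg-X : ∀ i (b : Monomial) → deg (X i · b) ≡ suc (deg b)
deg-X 0F (x ∷ y ∷ z ∷ []) = refl
deg-X 1F (x ∷ y ∷ z ∷ []) = +-suc x (y + (z + 0))
deg-X 2F (x ∷ y ∷ z ∷ []) = trans (cong (_+_ x) (+-suc y (z + 0))) (+-suc x (y + (z + 0)))

∣-X : ∀ i (b : Monomial) → b ∣ X i · b
∣-X 0F (x ∷ y ∷ z ∷ []) = n≤1+n x ∷ ≤-refl ∷ ≤-refl ∷ []
∣-X 1F (x ∷ y ∷ z ∷ []) = ≤-refl ∷ n≤1+n y ∷ ≤-refl ∷ []
∣-X 2F (x ∷ y ∷ z ∷ []) = ≤-refl ∷ ≤-refl ∷ n≤1+n z ∷ []

X₀-injective : ∀ {u v} → X 0F · u ≡ X 0F · v → u ≡ v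
X₀-injective {_ ∷ _} {_ ∷ _} refl = refl

xdeg : Monomial → ℕ
xdeg u = lookup u 0F

𝟏 : Monomial
𝟏 = 0 ∷ 0 ∷ 0 ∷ []

𝟏∣ : ∀ u → 𝟏 ∣ u
𝟏∣ (x ∷ y ∷ z ∷ []) = z≤n ∷ z≤n ∷ z≤n ∷ []

bottomRow : ℕ → List (Vec ℕ 2)
bottomRow zero    = (0 ∷ 0 ∷ []) ∷ []
bottomRow (suc n) = map (λ v → updateAt v 0F suc) (bottomRow n) ++ (0 ∷ suc n ∷ []) ∷ []

-- The multiples of x come first, so the x-exponent never increases along the list; the sweep relies
-- on this order.
monomials : ℕ → List Monomial
monomials zero    = 𝟏 ∷ []
monomials (suc n) = map (X 0F ·_) (monomials n) ++ map (0 ∷_) (bottomRow (suc n))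

-- The monomials of degree n - 1; there are none for n = 0.
monomials⁻ : ℕ → List Monomial
monomials⁻ zero    = []
monomials⁻ (suc n) = monomials n

∈-bottomRow⁻ : ∀ n {v} → v ∈ bottomRow n → Vec.sum v ≡ n
∈-bottomRow⁻ zero    (here refl) = refl
∈-bottomRow⁻ (suc n) v∈ with ∈-++⁻ (map _ (bottomRow n)) v∈
... | inj₂ (here refl) = cong suc (+-identityʳ n)
... | inj₁ v∈′ with ∈-map⁻ _ v∈′
...   | (y ∷ z ∷ []) , w∈ , refl = cong suc (∈-bottomRow⁻ n w∈)

∈-bottomRow⁺ : ∀ n y z → y + (z + 0) ≡ n → (y ∷ z ∷ []) ∈ bottomRow n
∈-bottomRow⁺ zero    zero    zero    eq   = here refl
∈-bottomRow⁺ (suc n) zero    (suc z) eq with suc-injective eq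
... | eq′ rewrite trans (sym (+-identityʳ z)) eq′ = ∈-++⁺ʳ (map _ (bottomRow n)) (here refl)
∈-bottomRow⁺ (suc n) (suc y) z       eq   =
  ∈-++⁺ˡ (∈-map⁺ (λ v → updateAt v 0F suc) (∈-bottomRow⁺ n y z (suc-injective eq)))

∈-monomials⁻ : ∀ n {u} → u ∈ monomials n → deg u ≡ n
∈-monomials⁻ zero    (here refl) = refl
∈-monomials⁻ (suc n) u∈ with ∈-++⁻ (map (X 0F ·_) (monomials n)) u∈
... | inj₁ u∈′ with ∈-map⁻ _ u∈′
...   | v , v∈ , refl = trans (deg-X 0F v) (cong suc (∈-monomials⁻ n v∈))
∈-monomials⁻ (suc n) u∈ | inj₂ u∈′ with ∈-map⁻ _ u∈′
...   | v , v∈ , refl = ∈-bottomRow⁻ (suc n) v∈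

∈-monomials⁺ : ∀ {n u} → deg u ≡ n → u ∈ monomials n
∈-monomials⁺ {zero}  {zero ∷ zero ∷ zero ∷ []} eq = here refl
∈-monomials⁺ {suc n} {zero  ∷ y ∷ z ∷ []} eq =
  ∈-++⁺ʳ (map _ (monomials n)) (∈-map⁺ (0 ∷_) (∈-bottomRow⁺ (suc n) y z eq))
∈-monomials⁺ {suc n} {suc x ∷ y ∷ z ∷ []} eq =
  ∈-++⁺ˡ (∈-map⁺ (X 0F ·_) (∈-monomials⁺ {n} {x ∷ y ∷ z ∷ []} (suc-injective eq)))

∈-monomials⁻⁻ : ∀ n {b} → b ∈ monomials⁻ n → suc (deg b) ≡ n
∈-monomials⁻⁻ (suc n) b∈ = cong suc (∈-monomials⁻ n b∈)

∈-monomials⁻⁺ : ∀ {n b} → suc (deg b) ≡ n → b ∈ monomials⁻ n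
∈-monomials⁻⁺ {suc n} eq = ∈-monomials⁺ (suc-injective eq)

-- w is above v in the order in which the sweep removes triangles.
Above : Monomial → Monomial → Set
Above w v = w ≢ v × xdeg v ≤ xdeg w

bottomRow-unique : ∀ n → Unique (bottomRow n)
bottomRow-unique zero    = [] ∷ []
bottomRow-unique (suc n) = Unique.++⁺ (Unique.map⁺ inj (bottomRow-unique n)) ([] ∷ []) disj
  where
  inj : ∀ {v w : Vec ℕ 2} → updateAt v 0F suc ≡ updateAt w 0F suc → v ≡ w
  inj {y ∷ z ∷ []} {_ ∷ _ ∷ []} refl = refl
  disj : ∀ {v} → ¬ (v ∈ map (λ v → updateAt v 0F suc) (bottomRow n) × v ∈ (0 ∷ suc n ∷ []) ∷ [])
  disj (p , here refl) with ∈-map⁻ _ p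
  ... | (_ ∷ _ ∷ []) , _ , ()

monomials-sorted : ∀ n → AllPairs Above (monomials n)
monomials-sorted zero    = [] ∷ []
monomials-sorted (suc n) = AllPairs.++⁺
  (AllPairs.map⁺ (AllPairs.map (λ { {_ ∷ _} {_ ∷ _} (v≢w , le) → (λ eq → v≢w (X₀-injective eq)) , s≤s le })
    (monomials-sorted n)))
  (AllPairs.map⁺ (AllPairs.map (λ v≢w → (λ { refl → v≢w refl }) , z≤n) (bottomRow-unique (suc n))))
  (All.map⁺ (All.tabulate λ { {_ ∷ _} _ → All.map⁺ (All.tabulate λ _ → (λ ()) , z≤n) }))

monomials-unique : ∀ n → Unique (monomials n)
monomials-unique n = AllPairs.map proj₁ (monomials-sorted n)

monomials⁻-unique : ∀ n → Unique (monomials⁻ n)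
monomials⁻-unique zero    = []
monomials⁻-unique (suc n) = monomials-unique n

Σ-monomials : ∀ n f →
  Σ (monomials (suc n)) f ≡ Σ (monomials n) (f ∘ (X 0F ·_)) + Σ (bottomRow (suc n)) (f ∘ (0 ∷_))
Σ-monomials n f = trans (Σ-++ (map (X 0F ·_) (monomials n)) _ f)
  (cong₂ _+_ (Σ-map (X 0F ·_) (monomials n) f) (Σ-map (0 ∷_) (bottomRow (suc n)) f))

-- A puncture of side s has s more upward-pointing than downward-pointing triangles.
countMultiples : ∀ n g →
  Σ (monomials n) (λ u → 𝟙 (g ∣? u)) ≡ Σ (monomials⁻ n) (λ u → 𝟙 (g ∣? u)) + (suc n ∸ deg g)
countMultiples zero    (zero  ∷ zero  ∷ zero  ∷ []) = refl
countMultiples zero    (zero  ∷ zero  ∷ suc z ∷ []) = sym (0∸n≡0 (z + 0))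
countMultiples zero    (zero  ∷ suc y ∷ z     ∷ []) = sym (0∸n≡0 (y + (z + 0)))
countMultiples zero    (suc x ∷ y     ∷ z     ∷ []) = sym (0∸n≡0 (x + (y + (z + 0))))
-- Here division by x matches the upward-pointing multiples of `g` above the bottom row with the
-- downward-pointing ones, so the surplus is what `g` has in the bottom row.
countMultiples (suc n) (zero ∷ y ∷ z ∷ []) = begin
  Σ (monomials (suc n)) (λ u → 𝟙 (g ∣? u))
    ≡⟨ Σ-monomials n _ ⟩
  Σ (monomials n) (λ u → 𝟙 (g ∣? X 0F · u)) + Σ (bottomRow (suc n)) (λ v → 𝟙 (g ∣? 0 ∷ v))
    ≡⟨ cong₂ _+_
         (Σ-cong (monomials n) (λ { {a ∷ b ∷ c ∷ []} _ → 𝟙-cong (g ∣? (suc a ∷ b ∷ c ∷ [])) (g ∣? (a ∷ b ∷ c ∷ []))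
           (λ { (_ ∷ p) → z≤n ∷ p }) (λ { (_ ∷ p) → z≤n ∷ p }) }))
         (Σ-cong (bottomRow (suc n)) (λ { {v} _ → 𝟙-cong (g ∣? (0 ∷ v)) ((y ∷ z ∷ []) ∣₂? v)
           (λ { (_ ∷ p) → p }) (z≤n ∷_) })) ⟩
  Σ (monomials n) (λ u → 𝟙 (g ∣? u)) + Σ (bottomRow (suc n)) (λ v → 𝟙 ((y ∷ z ∷ []) ∣₂? v))
    ≡⟨ cong (_+_ (Σ (monomials n) (λ u → 𝟙 (g ∣? u)))) (countRow (suc n) y z) ⟩
  Σ (monomials n) (λ u → 𝟙 (g ∣? u)) + (2 + n ∸ (y + (z + 0))) ∎
  where
  open ≡-Reasoning
  g : Monomial
  g = zero ∷ y ∷ z ∷ []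
  _∣₂?_ : (u v : Vec ℕ 2) → Dec (Pointwise _≤_ u v)
  _∣₂?_ = Pointwise.decidable _≤?_
  countRow : ∀ n y z → Σ (bottomRow n) (λ v → 𝟙 ((y ∷ z ∷ []) ∣₂? v)) ≡ suc n ∸ (y + (z + 0))
  countRow zero    zero    zero    = refl
  countRow zero    zero    (suc z) = sym (0∸n≡0 (z + 0))
  countRow zero    (suc y) z       = sym (0∸n≡0 (y + (z + 0)))
  countRow (suc n) y       z       =
    trans (Σ-++ (map _ (bottomRow n)) _ _) (trans (cong₂ _+_ (Σ-map _ (bottomRow n) _) refl) (step y z))
    where
    step : ∀ y z → Σ (bottomRow n) (λ v → 𝟙 ((y ∷ z ∷ []) ∣₂? updateAt v 0F suc))
      + (𝟙 ((y ∷ z ∷ []) ∣₂? (0 ∷ suc n ∷ [])) + 0) ≡ suc (suc n) ∸ (y + (z + 0))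
    step (suc y) z = begin
      Σ (bottomRow n) (λ v → 𝟙 ((suc y ∷ z ∷ []) ∣₂? updateAt v 0F suc)) + _
        ≡⟨ cong₂ _+_
            (Σ-cong (bottomRow n) (λ { {a ∷ c ∷ []} _ → 𝟙-cong ((suc y ∷ z ∷ []) ∣₂? (suc a ∷ c ∷ [])) ((y ∷ z ∷ []) ∣₂? (a ∷ c ∷ []))
              (λ { (s≤s p ∷ q) → p ∷ q }) (λ { (p ∷ q) → s≤s p ∷ q }) }))
            (cong (_+ 0) (𝟙-false ((suc y ∷ z ∷ []) ∣₂? (0 ∷ suc n ∷ [])) λ { (() ∷ _) })) ⟩
      Σ (bottomRow n) (λ v → 𝟙 ((y ∷ z ∷ []) ∣₂? v)) + 0
        ≡⟨ +-identityʳ _ ⟩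
      Σ (bottomRow n) (λ v → 𝟙 ((y ∷ z ∷ []) ∣₂? v))
        ≡⟨ countRow n y z ⟩
      suc n ∸ (y + (z + 0)) ∎
    step zero z = begin
      Σ (bottomRow n) (λ v → 𝟙 ((0 ∷ z ∷ []) ∣₂? updateAt v 0F suc)) + last
        ≡⟨ cong (_+ last) (trans (Σ-cong (bottomRow n) (λ { {a ∷ c ∷ []} _ → 𝟙-cong ((0 ∷ z ∷ []) ∣₂? (suc a ∷ c ∷ [])) ((0 ∷ z ∷ []) ∣₂? (a ∷ c ∷ []))
              (λ { (_ ∷ q) → z≤n ∷ q }) (λ { (p ∷ q) → z≤n ∷ q }) })) (countRow n 0 z)) ⟩
      (suc n ∸ (z + 0)) + last
        ≡⟨ cong₂ (λ a b → (suc n ∸ a) + b) (+-identityʳ z) (+-identityʳ _) ⟩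
      (suc n ∸ z) + 𝟙 ((0 ∷ z ∷ []) ∣₂? (0 ∷ suc n ∷ []))
        ≡⟨ end ⟩
      suc (suc n) ∸ z
        ≡⟨ cong (suc (suc n) ∸_) (+-identityʳ z) ⟨
      suc (suc n) ∸ (z + 0) ∎
      where
      last = 𝟙 ((0 ∷ z ∷ []) ∣₂? (0 ∷ suc n ∷ [])) + 0
      end : (suc n ∸ z) + 𝟙 ((0 ∷ z ∷ []) ∣₂? (0 ∷ suc n ∷ [])) ≡ suc (suc n) ∸ z
      end with z ≤? suc n
      ... | yes z≤ = trans (cong ((suc n ∸ z) +_) (𝟙-true ((0 ∷ z ∷ []) ∣₂? (0 ∷ suc n ∷ [])) (z≤n ∷ z≤ ∷ [])))
                       (trans (+-comm _ 1) (sym (+-∸-assoc 1 z≤)))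
      ... | no  z≰ = trans (cong₂ _+_ (m≤n⇒m∸n≡0 (<⇒≤ (≰⇒> z≰)))
                         (𝟙-false ((0 ∷ z ∷ []) ∣₂? (0 ∷ suc n ∷ [])) λ { (_ ∷ p ∷ _) → z≰ p }))
                       (sym (m≤n⇒m∸n≡0 (≰⇒> z≰)))
-- Division by x turns both counts into those of `g` one degree lower, and the side stays the same.
countMultiples (suc n) (suc x ∷ y ∷ z ∷ []) = begin
  Σ (monomials (suc n)) (λ u → 𝟙 (xg ∣? u))
    ≡⟨ shiftX n ⟩
  Σ (monomials n) (λ u → 𝟙 (g ∣? u))
    ≡⟨ countMultiples n g ⟩
  Σ (monomials⁻ n) (λ u → 𝟙 (g ∣? u)) + (suc n ∸ deg g)
    ≡⟨ cong (_+ (suc n ∸ deg g)) (shiftX⁻ n) ⟨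
  Σ (monomials n) (λ u → 𝟙 (xg ∣? u)) + (suc n ∸ deg g) ∎
  where
  open ≡-Reasoning
  g xg : Monomial
  g  = x ∷ y ∷ z ∷ []
  xg = suc x ∷ y ∷ z ∷ []
  shiftX : ∀ n → Σ (monomials (suc n)) (λ u → 𝟙 (xg ∣? u)) ≡ Σ (monomials n) (λ u → 𝟙 (g ∣? u))
  shiftX n = begin
    Σ (monomials (suc n)) (λ u → 𝟙 (xg ∣? u))
      ≡⟨ Σ-monomials n _ ⟩
    Σ (monomials n) (λ u → 𝟙 (xg ∣? X 0F · u)) + Σ (bottomRow (suc n)) (λ v → 𝟙 (xg ∣? 0 ∷ v))
      ≡⟨ cong₂ _+_
           (Σ-cong (monomials n) (λ { {a ∷ b ∷ c ∷ []} _ → 𝟙-cong (xg ∣? (suc a ∷ b ∷ c ∷ [])) (g ∣? (a ∷ b ∷ c ∷ []))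
             (λ { (s≤s p ∷ q) → p ∷ q }) (λ { (p ∷ q) → s≤s p ∷ q }) }))
           (trans (Σ-cong (bottomRow (suc n)) {g = λ _ → 0} (λ { {v} _ → 𝟙-false (xg ∣? (0 ∷ v)) λ { (() ∷ _) } }))
             (trans (Σ-const (bottomRow (suc n)) 0) (*-zeroʳ (length (bottomRow (suc n)))))) ⟩
    Σ (monomials n) (λ u → 𝟙 (g ∣? u)) + 0
      ≡⟨ +-identityʳ _ ⟩
    Σ (monomials n) (λ u → 𝟙 (g ∣? u)) ∎
  shiftX⁻ : ∀ n → Σ (monomials n) (λ u → 𝟙 (xg ∣? u)) ≡ Σ (monomials⁻ n) (λ u → 𝟙 (g ∣? u))
  shiftX⁻ zero    = refl
  shiftX⁻ (suc n) = shiftX n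

-- b ↦ x b is injective, so a function growing along it has the larger sum on the upward-pointing triangles.
Σ-monomials⁻-≤ : ∀ n {f} → (∀ b → f b ≤ f (X 0F · b)) → Σ (monomials⁻ n) f ≤ Σ (monomials n) f
Σ-monomials⁻-≤ zero    f≤ = z≤n
Σ-monomials⁻-≤ (suc n) {f} f≤ = begin
  Σ (monomials n) f                  ≤⟨ Σ-mono (monomials n) (λ {b} _ → f≤ b) ⟩
  Σ (monomials n) (f ∘ (X 0F ·_))    ≤⟨ m≤m+n _ _ ⟩
  Σ (monomials n) (f ∘ (X 0F ·_)) + Σ (bottomRow (suc n)) (f ∘ (0 ∷_)) ≡⟨ Σ-monomials n f ⟨
  Σ (monomials (suc n)) f            ∎
  where open ≤-Reasoning

-- Equality forces f (x b) = f b ≤ f (y b) and f = 0 for x-exponent 0, so f vanishes by induction on the x-exponent.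
Σ-monomials⁻-≡ : ∀ n {f} → (∀ i b → f b ≤ f (X i · b)) →
  Σ (monomials n) f ≤ Σ (monomials⁻ n) f → ∀ {u} → deg u ≡ n → f u ≡ 0
Σ-monomials⁻-≡ zero    {f} f≤ sums degu = Σ-≡0 (monomials 0) {f} (n≤0⇒n≡0 sums) (∈-monomials⁺ degu)
Σ-monomials⁻-≡ (suc n) {f} f≤ sums {u} degu = descend (xdeg u) u refl degu
  where
  rowΣ = Σ (bottomRow (suc n)) (f ∘ (0 ∷_))
  row≡0 : rowΣ ≡ 0
  row≡0 = n≤0⇒n≡0 (+-cancelˡ-≤ (Σ (monomials n) (f ∘ (X 0F ·_))) rowΣ 0
    (≤-respˡ (Σ-monomials n f) (≤-trans sums (≤-trans (Σ-mono (monomials n) (λ {b} _ → f≤ 0F b))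
      (≤-reflexive (sym (+-identityʳ _)))))))
    where
    ≤-respˡ : ∀ {a b c} → a ≡ b → a ≤ c → b ≤ c
    ≤-respˡ refl p = p
  level : ∀ {b} → deg b ≡ n → f (X 0F · b) ≤ f b
  level {b} degb with f (X 0F · b) ≤? f b
  ... | yes p = p
  ... | no ¬p = contradiction
    (≤-trans (≤-reflexive (+-comm 1 _))
    (≤-trans (Σ-mono-at (monomials n) (λ {b} _ → f≤ 0F b) (∈-monomials⁺ degb) (≤-trans (≤-reflexive (+-comm (f b) 1)) (≰⇒> ¬p)))
    (≤-trans (m≤m+n _ rowΣ) (≤-trans (≤-reflexive (sym (Σ-monomials n f))) sums)))) (<-irrefl refl)
  descend : ∀ k u → xdeg u ≡ k → deg u ≡ suc n → f u ≡ 0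
  descend zero    (.0 ∷ y ∷ z ∷ []) refl degu = Σ-≡0 (bottomRow (suc n)) row≡0 (∈-bottomRow⁺ (suc n) y z degu)
  descend (suc k) (.(suc k) ∷ y ∷ z ∷ []) refl degu = n≤0⇒n≡0 (begin
    f (X 0F · b)  ≤⟨ level (suc-injective degu) ⟩
    f b           ≤⟨ f≤ 1F b ⟩
    f (X 1F · b)  ≡⟨ descend k (X 1F · b) refl (trans (deg-X 1F b) degu) ⟩
    0             ∎)
    where
    open ≤-Reasoning
    b : Monomial
    b = k ∷ y ∷ z ∷ []

-- Hall's theorem

Unique-resp-↭ : {xs ys : List A} → xs ↭ ys → Unique xs → Unique ys
Unique-resp-↭ xs↭ys = Permutation.Unique-resp-↭ (setoid _) (↭⇒↭ₛ xs↭ys)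

remove : {x : A} {xs : List A} → x ∈ xs → ∃ λ xs′ → xs ↭ x ∷ xs′
remove x∈xs with ∈-∃++ x∈xs
... | as , bs , refl = as ++ bs , shift _ as bs

-- A failed search for an augmenting path from an unmatched element returns a set of pairs of the
-- matching that is closed under passing to neighbours, and these violate Hall's condition.
module Hall {A B : Set} (_≟ᴮ_ : (x y : B) → Dec (x ≡ y)) where

  -- Only the right ends are recorded as distinct; the left ends are controlled by permutations as
  -- in `Augmented`.
  IsMatching : (A → List B) → List (A × B) → Set
  IsMatching nbr M = All (λ p → proj₂ p ∈ nbr (proj₁ p)) M × Unique (map proj₂ M)

  Augmented : (A → List B) → List (A × B) → A → Set
  Augmented nbr M a = ∃ λ M′ → IsMatching nbr M′ × map proj₁ M′ ↭ a ∷ map proj₁ M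

  Closed : (A → List B) → List (A × B) → Set
  Closed nbr V = ∀ {p r} → p ∈ V → r ∈ nbr (proj₁ p) → r ∈ map proj₂ V

  -- The certificate that no augmenting path passes through any of `rs`: alternating paths from
  -- there never leave `V`.
  Blocked : (A → List B) → List (A × B) → List B → Set
  Blocked nbr M rs = ∃ λ V → (∀ {p} → p ∈ V → p ∈ M) × Closed nbr V × (∀ {r} → r ∈ rs → r ∈ map proj₂ V)

  nbrExcept : B → (A → List B) → A → List B
  nbrExcept r nbr x = filter (λ r′ → ¬? (r ≟ᴮ r′)) (nbr x)

  nbrExcept⁻ : ∀ {r} nbr {x r′} → r′ ∈ nbrExcept r nbr x → r′ ∈ nbr x × r ≢ r′
  nbrExcept⁻ {r} nbr {x} = ∈-filter⁻ (λ r′ → ¬? (r ≟ᴮ r′)) {xs = nbr x}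

  removePair : ∀ nbr {M M₁ l r} → M ↭ (l , r) ∷ M₁ → IsMatching nbr M → IsMatching (nbrExcept r nbr) M₁
  removePair nbr {r = r} M↭ (edges , rights!) with Unique-resp-↭ (↭-map⁺ proj₂ M↭) rights!
  ... | r∉ ∷ rights₁! = All.tabulate (λ p∈ → ∈-filter⁺ (λ r′ → ¬? (r ≟ᴮ r′))
        (All.lookup edges (∈-resp-↭ (↭-sym M↭) (there p∈))) (All.lookup r∉ (∈-map⁺ proj₂ p∈))) , rights₁!

  -- `V₁` is closed only in the graph without `r`. Adding the pair `(l , r)` repairs this, since the
  -- other neighbours of `l` are right ends of `V₁`.
  blockPair : ∀ nbr {M M₁ l r rs} → M ↭ (l , r) ∷ M₁ →
    Blocked (nbrExcept r nbr) M₁ (nbrExcept r nbr l) → Blocked nbr M rs → Blocked nbr M (r ∷ rs)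
  blockPair nbr {M} {M₁} {l} {r} M↭ (V₁ , V₁⊆ , closed₁ , closedˡ) (V₂ , V₂⊆ , closed₂ , closedᵣₛ) =
    W , W⊆ , closed , λ { (here refl) → here refl ; (there r∈) → right₂ (closedᵣₛ r∈) }
    where
    W : List (A × B)
    W = (l , r) ∷ V₁ ++ V₂
    right₁ : ∀ {r′} → r′ ∈ map proj₂ V₁ → r′ ∈ map proj₂ W
    right₁ r′∈ with ∈-map⁻ proj₂ r′∈
    ... | p , p∈ , refl = ∈-map⁺ proj₂ {xs = W} (there (∈-++⁺ˡ p∈))
    right₂ : ∀ {r′} → r′ ∈ map proj₂ V₂ → r′ ∈ map proj₂ W
    right₂ r′∈ with ∈-map⁻ proj₂ r′∈
    ... | p , p∈ , refl = ∈-map⁺ proj₂ {xs = W} (there (∈-++⁺ʳ V₁ p∈))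
    W⊆ : ∀ {p} → p ∈ W → p ∈ M
    W⊆ (here refl) = ∈-resp-↭ (↭-sym M↭) (here refl)
    W⊆ (there p∈) with ∈-++⁻ V₁ p∈
    ... | inj₁ p∈V₁ = ∈-resp-↭ (↭-sym M↭) (there (V₁⊆ p∈V₁))
    ... | inj₂ p∈V₂ = V₂⊆ p∈V₂
    except : ∀ {x} → (∀ {r′} → r′ ∈ nbrExcept r nbr x → r′ ∈ map proj₂ V₁) →
      ∀ {r′} → r′ ∈ nbr x → r′ ∈ map proj₂ W
    except into {r′} r′∈ with r ≟ᴮ r′
    ... | yes refl = here refl
    ... | no  r≢r′ = right₁ (into (∈-filter⁺ (λ r′ → ¬? (r ≟ᴮ r′)) r′∈ r≢r′))
    closed : Closed nbr W
    closed (here refl) = except {l} closedˡ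
    closed {p} (there p∈) r′∈ with ∈-++⁻ V₁ p∈
    ... | inj₁ p∈V₁ = except {proj₁ p} (closed₁ p∈V₁) r′∈
    ... | inj₂ p∈V₂ = right₂ (closed₂ p∈V₂ r′∈)

  -- The neighbours of `a` are tried in turn. A matched `r` is freed by deleting it from the graph
  -- and rematching its partner `l` within the shorter remaining matching, which is the task of
  -- `rec`.
  search : ∀ nbr M → IsMatching nbr M → ∀ a →
    (∀ nbr′ M₁ → length M₁ < length M → IsMatching nbr′ M₁ → ∀ l → Augmented nbr′ M₁ l ⊎ Blocked nbr′ M₁ (nbr′ l)) →
    ∀ rs → (∀ {r} → r ∈ rs → r ∈ nbr a) → Augmented nbr M a ⊎ Blocked nbr M rs
  search nbr M matching a rec [] rs⊆ = inj₂ ([] , (λ ()) , (λ ()) , λ ())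
  search nbr M matching@(edges , rights!) a rec (r ∷ rs) rs⊆ with Any.any? (r ≟ᴮ_) (map proj₂ M)
  ... | no r∉ = inj₁ ((a , r) ∷ M , (rs⊆ (here refl) ∷ edges , All.¬Any⇒All¬ _ r∉ ∷ rights!) , ↭-refl)
  ... | yes r∈ with ∈-map⁻ proj₂ r∈
  ...   | (l , .r) , p∈M , refl with remove p∈M
  ...     | M₁ , M↭ with rec (nbrExcept r nbr) M₁ (≤-reflexive (sym (↭-length M↭))) (removePair nbr M↭ matching) l
  ...       | inj₁ (M′ , (edges′ , rights′!) , M′↭) = inj₁ ((a , r) ∷ M′ ,
              (rs⊆ (here refl) ∷ All.map (λ {p} → proj₁ ∘ nbrExcept⁻ nbr {proj₁ p}) edges′ ,
               All.map⁺ (All.map (λ {p} → proj₂ ∘ nbrExcept⁻ nbr {proj₁ p}) edges′) ∷ rights′!) ,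
              ↭-prep a (↭-trans M′↭ (↭-sym (↭-map⁺ proj₁ M↭))))
  ...       | inj₂ blocked with search nbr M matching a rec rs (rs⊆ ∘ there)
  ...         | inj₁ augmented = inj₁ augmented
  ...         | inj₂ blocked′  = inj₂ (blockPair nbr M↭ blocked blocked′)

  augment : ∀ k nbr M → length M ≤ k → IsMatching nbr M → ∀ a → Augmented nbr M a ⊎ Blocked nbr M (nbr a)
  augment zero    nbr M len matching a =
    search nbr M matching a (λ _ _ lt → contradiction (≤-trans lt len) λ ()) (nbr a) id
  augment (suc k) nbr M len matching a =
    search nbr M matching a (λ nbr′ M₁ lt → augment k nbr′ M₁ (s≤s⁻¹ (≤-trans lt len))) (nbr a) id

  HallCondition : (A → List B) → List A → Set
  HallCondition nbr L = ∀ {as rs} → Unique as → (∀ {a} → a ∈ as → a ∈ L) →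
    (∀ {a r} → a ∈ as → r ∈ nbr a → r ∈ rs) → length as ≤ length rs

  hall : ∀ nbr L → Unique L → HallCondition nbr L → ∃ λ M → IsMatching nbr M × map proj₁ M ↭ L
  hall nbr []      _          _    = [] , ([] , []) , ↭-refl
  hall nbr (a ∷ L) (a∉L ∷ L!) cond with hall nbr L L! (λ as! as⊆ → cond as! (there ∘ as⊆))
  ... | M , matching , M↭L with augment (length M) nbr M ≤-refl matching a
  ...   | inj₁ (M′ , matching′ , M′↭) = M′ , matching′ , ↭-trans M′↭ (↭-prep a M↭L)
  ...   | inj₂ (V , V⊆M , closed , a-closed) = contradiction violation (<⇒≱ (n<1+n _))
    where
    V? : Decidable (λ (p : A × B) → proj₂ p ∈ map proj₂ V)
    V? p = Any.any? (proj₂ p ≟ᴮ_) (map proj₂ V)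
    -- `V` may repeat pairs, as certificates are concatenated. Filtering the matching gives the same
    -- right ends without repetition.
    V′ : List (A × B)
    V′ = filter V? M
    V⊆V′ : ∀ {p} → p ∈ V → p ∈ V′
    V⊆V′ p∈ = ∈-filter⁺ V? (V⊆M p∈) (∈-map⁺ proj₂ p∈)
    rights : ∀ {r} → r ∈ map proj₂ V → r ∈ map proj₂ V′
    rights r∈ with ∈-map⁻ proj₂ r∈
    ... | p , p∈ , refl = ∈-map⁺ proj₂ (V⊆V′ p∈)
    lefts! : Unique (map proj₁ V′)
    lefts! = AllPairs.map⁺ (AllPairs.filter⁺ V? (AllPairs.map⁻ (Unique-resp-↭ (↭-sym M↭L) L!)))
    lefts⊆ : ∀ {l} → l ∈ map proj₁ V′ → l ∈ L
    lefts⊆ l∈ with ∈-map⁻ proj₁ l∈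
    ... | p , p∈ , refl = ∈-resp-↭ M↭L (∈-map⁺ proj₁ (proj₁ (∈-filter⁻ V? p∈)))
    same-right : ∀ {p q M} → Unique (map proj₂ M) → p ∈ M → q ∈ M → proj₂ p ≡ proj₂ q → p ≡ q
    same-right _          (here refl) (here refl) _  = refl
    same-right (p∉ ∷ _)   (here refl) (there q∈)  eq = contradiction eq (All.lookup p∉ (∈-map⁺ proj₂ q∈))
    same-right (q∉ ∷ _)   (there p∈)  (here refl) eq = contradiction (sym eq) (All.lookup q∉ (∈-map⁺ proj₂ p∈))
    same-right (_ ∷ M!)   (there p∈)  (there q∈)  eq = same-right M! p∈ q∈ eq
    nbrs : ∀ {l r} → l ∈ a ∷ map proj₁ V′ → r ∈ nbr l → r ∈ map proj₂ V′
    nbrs (here refl) r∈ = rights (a-closed r∈)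
    nbrs (there l∈)  r∈ with ∈-map⁻ proj₁ l∈
    ... | p , p∈ , refl with ∈-filter⁻ V? {xs = M} p∈
    ...   | p∈M , right∈ with ∈-map⁻ proj₂ right∈
    ...     | q , q∈V , eq with same-right (proj₂ matching) p∈M (V⊆M q∈V) eq
    ...       | refl = rights (closed q∈V r∈)
    -- The left ends of `V′` together with `a` have all their neighbours among the right ends of
    -- `V′`, which are one fewer.
    violation : suc (length V′) ≤ length V′
    violation = begin
      suc (length V′)               ≡⟨ cong suc (length-map proj₁ V′) ⟨
      length (a ∷ map proj₁ V′)     ≤⟨ cond (All.tabulate (λ l∈ eq → All.lookup a∉L (lefts⊆ l∈) eq) ∷ lefts!)
                                         (λ { (here refl) → here refl ; (there l∈) → there (lefts⊆ l∈) }) nbrs ⟩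
      length (map proj₂ V′)         ≡⟨ length-map proj₂ V′ ⟩
      length V′                     ∎
      where open ≤-Reasoning

-- Families of triangles and the sweep

gcd lcm : Monomial → Monomial → Monomial
gcd = Vec.zipWith _⊓_
lcm = Vec.zipWith _⊔_

gcd∣ˡ : ∀ u v → gcd u v ∣ u
gcd∣ˡ (a ∷ b ∷ c ∷ []) (a′ ∷ b′ ∷ c′ ∷ []) = m⊓n≤m a a′ ∷ m⊓n≤m b b′ ∷ m⊓n≤m c c′ ∷ []

gcd∣ʳ : ∀ u v → gcd u v ∣ v
gcd∣ʳ (a ∷ b ∷ c ∷ []) (a′ ∷ b′ ∷ c′ ∷ []) = m⊓n≤n a a′ ∷ m⊓n≤n b b′ ∷ m⊓n≤n c c′ ∷ []

gcd-greatest : ∀ {u v w} → u ∣ v → u ∣ w → u ∣ gcd v w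
gcd-greatest (a ∷ b ∷ c ∷ []) (a′ ∷ b′ ∷ c′ ∷ []) = ⊓-glb a a′ ∷ ⊓-glb b b′ ∷ ⊓-glb c c′ ∷ []

∣lcmˡ : ∀ u v → u ∣ lcm u v
∣lcmˡ (a ∷ b ∷ c ∷ []) (a′ ∷ b′ ∷ c′ ∷ []) = m≤m⊔n a a′ ∷ m≤m⊔n b b′ ∷ m≤m⊔n c c′ ∷ []

∣lcmʳ : ∀ u v → v ∣ lcm u v
∣lcmʳ (a ∷ b ∷ c ∷ []) (a′ ∷ b′ ∷ c′ ∷ []) = m≤n⊔m a a′ ∷ m≤n⊔m b b′ ∷ m≤n⊔m c c′ ∷ []

lcm-least : ∀ {u v w} → u ∣ w → v ∣ w → lcm u v ∣ w
lcm-least (a ∷ b ∷ c ∷ []) (a′ ∷ b′ ∷ c′ ∷ []) = ⊔-lub a a′ ∷ ⊔-lub b b′ ∷ ⊔-lub c c′ ∷ []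

⊓+⊔ : ∀ m n → (m ⊓ n) + (m ⊔ n) ≡ m + n
⊓+⊔ m n with ≤-total m n
... | inj₁ m≤n = cong₂ _+_ (m≤n⇒m⊓n≡m m≤n) (m≤n⇒m⊔n≡n m≤n)
... | inj₂ n≤m = trans (cong₂ _+_ (m≥n⇒m⊓n≡n n≤m) (m≥n⇒m⊔n≡m n≤m)) (+-comm n m)

deg-gcd+deg-lcm : ∀ u v → deg (gcd u v) + deg (lcm u v) ≡ deg u + deg v
deg-gcd+deg-lcm (a ∷ b ∷ c ∷ []) (a′ ∷ b′ ∷ c′ ∷ []) =
  trans (rearrange (a ⊓ a′) (b ⊓ b′) (c ⊓ c′) (a ⊔ a′) (b ⊔ b′) (c ⊔ c′))
  (trans (cong₂ _+_ (⊓+⊔ a a′) (cong₂ _+_ (⊓+⊔ b b′) (⊓+⊔ c c′)))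
         (sym (rearrange a b c a′ b′ c′)))
  where
  rearrange : ∀ p q r p′ q′ r′ →
    p + (q + (r + 0)) + (p′ + (q′ + (r′ + 0))) ≡ p + p′ + (q + q′ + (r + r′))
  rearrange = solve-∀

lcm-comm : ∀ u v → lcm u v ≡ lcm v u
lcm-comm (a ∷ b ∷ c ∷ []) (a′ ∷ b′ ∷ c′ ∷ []) =
  cong₂ _∷_ (⊔-comm a a′) (cong₂ _∷_ (⊔-comm b b′) (cong (_∷ []) (⊔-comm c c′)))

Σ-resp-↭ : {xs ys : List A} (f : A → ℕ) → xs ↭ ys → Σ xs f ≡ Σ ys f
Σ-resp-↭ f _↭_.refl                   = refl
Σ-resp-↭ f (_↭_.prep x p)             = cong (_+_ (f x)) (Σ-resp-↭ f p)
Σ-resp-↭ f (_↭_.swap {xs} {ys} x y p) =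
  trans (cong (λ s → f x + (f y + s)) (Σ-resp-↭ f p)) (x∙yz≈y∙xz (f x) (f y) (Σ ys f))
  where
  x∙yz≈y∙xz : ∀ a b c → a + (b + c) ≡ b + (a + c)
  x∙yz≈y∙xz = solve-∀
Σ-resp-↭ f (_↭_.trans p q)            = trans (Σ-resp-↭ f p) (Σ-resp-↭ f q)

-- A monomial h stands for the triangle of side n + 1 - deg h formed by its multiples in the
-- triangle of side n + 1.
size : ℕ → Monomial → ℕ
size n h = suc n ∸ deg h

size-mono : ∀ n {h g} → h ∣ g → size n g ≤ size n h
size-mono n h∣g = ∸-monoʳ-≤ (suc n) (deg-mono h∣g)

-- Two triangles are apart if they do not even share a vertex of the subdivision.
Touching Apart : ℕ → Monomial → Monomial → Set
Touching n h k = deg (lcm h k) ≤ suc n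
Apart n h k    = ¬ Touching n h k

Apart-sym : ∀ {n h k} → Apart n h k → Apart n k h
Apart-sym {n} {h} {k} apart touch = apart (subst (λ l → deg l ≤ suc n) (lcm-comm k h) touch)

-- The gcd stands for the smallest triangle containing both. The degrees of gcd and lcm add up to
-- those of `h` and `k`, so a bound on the degree of the lcm bounds the side of the gcd.
size-gcd : ∀ n h k → Touching n h k → size n (gcd h k) ≤ size n h + size n k
size-gcd n h k touch = m≤n+o⇒m∸n≤o (suc n) (deg (gcd h k)) (+-cancelʳ-≤ (deg (lcm h k)) _ _ (begin
  suc n + deg (lcm h k)                                                ≤⟨ +-monoʳ-≤ (suc n) touch ⟩
  suc n + suc n                                                        ≡⟨ cong₂ _+_ (m∸n+n≡m h≤) (m∸n+n≡m k≤) ⟨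
  size n h + deg h + (size n k + deg k)                                ≡⟨ swap₁ (size n h) (deg h) (size n k) (deg k) ⟩
  size n h + size n k + (deg h + deg k)                                ≡⟨ cong (_+_ (size n h + size n k)) (deg-gcd+deg-lcm h k) ⟨
  size n h + size n k + (deg (gcd h k) + deg (lcm h k))                ≡⟨ swap₂ (size n h + size n k) (deg (gcd h k)) (deg (lcm h k)) ⟩
  deg (gcd h k) + (size n h + size n k) + deg (lcm h k)                ∎))
  where
  open ≤-Reasoning
  h≤ : deg h ≤ suc n
  h≤ = ≤-trans (deg-mono (∣lcmˡ h k)) touch
  k≤ : deg k ≤ suc n
  k≤ = ≤-trans (deg-mono (∣lcmʳ h k)) touch
  swap₁ : ∀ a b c d → a + b + (c + d) ≡ a + c + (b + d)
  swap₁ = solve-∀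
  swap₂ : ∀ a b c → a + (b + c) ≡ b + a + c
  swap₂ = solve-∀

record Family (n : ℕ) (H : List Monomial) : Set where
  field
    apart   : AllPairs (Apart n) H
    nonzero : All (λ h → deg h ≤ n) H

Covers : List Monomial → List Monomial → Set
Covers H W = ∀ {w} → w ∈ W → ∃ λ h → h ∈ H × h ∣ w

-- A merged triangle may touch further members, so it is inserted anew into the list without `p`;
-- `k` bounds the length of that list. By `size-gcd` merging does not increase the total side.
insert : ∀ k n H → length H ≤ k → Family n H → ∀ h → deg h ≤ n →
  ∃ λ H′ → Family n H′ × Covers H′ (h ∷ H) × Σ H′ (size n) ≤ size n h + Σ H (size n)
insert k n H len fam h h≤n with Any.any? (λ k → deg (lcm h k) ≤? suc n) H
... | no none = h ∷ H , record { apart = All.¬Any⇒All¬ H none ∷ Family.apart fam ; nonzero = h≤n ∷ Family.nonzero fam } ,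
  (λ w∈ → _ , w∈ , ∣-refl) , ≤-refl
... | yes some with find some
...   | p , p∈H , touch with remove p∈H
...     | H₁ , H↭ with k | ≤-trans (≤-reflexive (sym (↭-length H↭))) len
...       | suc k′ | s≤s len₁ with Permutation.AllPairs-resp-↭ (setoid Monomial) (λ {h} {k} → Apart-sym {n} {h} {k}) ((λ { refl → id }) , λ { refl → id })
                (↭⇒↭ₛ H↭) (Family.apart fam)
              | All-resp-↭ H↭ (Family.nonzero fam)
...         | _ ∷ apart₁ | _ ∷ nonzero₁ with insert k′ n H₁ len₁ (record { apart = apart₁ ; nonzero = nonzero₁ })
                                              (gcd h p) (≤-trans (deg-mono (gcd∣ˡ h p)) h≤n)
...           | H′ , fam′ , covers , sizes = H′ , fam′ , covers′ , (begin
    Σ H′ (size n)                               ≤⟨ sizes ⟩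
    size n (gcd h p) + Σ H₁ (size n)            ≤⟨ +-monoˡ-≤ _ (size-gcd n h p touch) ⟩
    size n h + size n p + Σ H₁ (size n)         ≡⟨ +-assoc (size n h) _ _ ⟩
    size n h + Σ (p ∷ H₁) (size n)              ≡⟨ cong (_+_ (size n h)) (Σ-resp-↭ (size n) H↭) ⟨
    size n h + Σ H (size n)                     ∎)
  where
  open ≤-Reasoning
  covers′ : Covers H′ (h ∷ H)
  covers′ (here refl) with covers (here refl)
  ... | k , k∈ , k∣ = k , k∈ , ∣-trans k∣ (gcd∣ˡ h p)
  covers′ (there w∈) with ∈-resp-↭ H↭ w∈
  ... | there w∈₁ = covers (there w∈₁)
  ... | here refl with covers (here refl)
  ...   | k , k∈ , k∣ = k , k∈ , ∣-trans k∣ (gcd∣ʳ h p)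

touching⇒≡ : ∀ {n H} → AllPairs (Apart n) H → ∀ {h k} → h ∈ H → k ∈ H → Touching n h k → h ≡ k
touching⇒≡ (_ ∷ _)      (here refl) (here refl) touch = refl
touching⇒≡ (apart ∷ _)  (here refl) (there k∈)  touch = contradiction touch (All.lookup apart k∈)
touching⇒≡ {n} (apart ∷ _) {h} {k} (there h∈) (here refl) touch =
  contradiction touch (Apart-sym {n} {k} {h} (All.lookup apart h∈))
touching⇒≡ (_ ∷ aparts) (there h∈)  (there k∈)  touch = touching⇒≡ aparts h∈ k∈ touch

∣-X⁻ : ∀ {h} g → h ∣ X 1F · g → h ∣ X 2F · g → h ∣ g
∣-X⁻ (x ∷ y ∷ z ∷ []) (p ∷ _ ∷ r ∷ []) (_ ∷ q ∷ _ ∷ []) = p ∷ q ∷ r ∷ []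

-- Both `h` and `k` divide y z g, whose degree is at most n + 1. So they touch and are the same
-- member, and a common divisor of y g and z g divides g.
commonDivisor-X : ∀ {n H} → Family n H → ∀ g → deg g < n → ∀ {h k} → h ∈ H → k ∈ H →
  h ∣ X 1F · g → k ∣ X 2F · g → h ∣ g
commonDivisor-X {n} fam g g<n {h} {k} h∈ k∈ h∣ k∣ =
  ∣-X⁻ g h∣ (subst (_∣ X 2F · g) (sym (touching⇒≡ (Family.apart fam) h∈ k∈ touch)) k∣)
  where
  X₁∣ : ∀ g → X 1F · g ∣ X 1F · X 2F · g
  X₁∣ (x ∷ y ∷ z ∷ []) = ≤-refl ∷ ≤-refl ∷ n≤1+n z ∷ []
  touch : Touching n h k
  touch = begin
    deg (lcm h k)           ≤⟨ deg-mono (lcm-least (∣-trans h∣ (X₁∣ g)) (∣-trans k∣ (∣-X 1F (X 2F · g)))) ⟩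
    deg (X 1F · X 2F · g)   ≡⟨ trans (deg-X 1F (X 2F · g)) (cong suc (deg-X 2F g)) ⟩
    suc (suc (deg g))       ≤⟨ s≤s g<n ⟩
    suc n                   ∎
    where open ≤-Reasoning

-- If `W` contains all unit triangles of a triangle, a single member of the family contains that
-- triangle. By induction on the side, members contain the subtriangles of y g and z g, and
-- `commonDivisor-X` identifies them.
covers-divisor : ∀ {n H W} → Family n H → Covers H W → ∀ k g → deg g + k ≡ n →
  (∀ {u} → deg u ≡ n → g ∣ u → u ∈ W) → ∃ λ h → h ∈ H × h ∣ g
covers-divisor fam covers zero    g eq ⊆W = covers (⊆W (trans (sym (+-identityʳ _)) eq) ∣-refl)
covers-divisor {n} fam covers (suc k) g eq ⊆W
  with covers-divisor fam covers k (X 1F · g) (next 1F) (λ u≡ → ⊆W u≡ ∘ ∣-trans (∣-X 1F g))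
     | covers-divisor fam covers k (X 2F · g) (next 2F) (λ u≡ → ⊆W u≡ ∘ ∣-trans (∣-X 2F g))
  where
  next : ∀ i → deg (X i · g) + k ≡ n
  next i = trans (cong (_+ k) (deg-X i g)) (trans (sym (+-suc (deg g) k)) eq)
... | h , h∈ , h∣ | l , l∈ , l∣ = h , h∈ ,
  commonDivisor-X fam g (≤-trans (s≤s (m≤m+n (deg g) k)) (≤-reflexive (trans (sym (+-suc (deg g) k)) eq))) h∈ l∈ h∣ l∣

xdeg-X₀ : ∀ b → xdeg (X 0F · b) ≡ suc (xdeg b)
xdeg-X₀ (_ ∷ _) = refl

xdeg-X : ∀ i b → i ≢ 0F → xdeg (X i · b) ≡ xdeg b
xdeg-X 0F b       i≢0 = contradiction refl i≢0
xdeg-X 1F (_ ∷ _) i≢0 = refl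
xdeg-X 2F (_ ∷ _) i≢0 = refl

-- If `w` were y b or z b, then x b, which also belongs to the list, would have a larger x-exponent
-- than its first entry `w`.
below : ∀ {w W} → All (Above w) W → ∀ {b} → X 0F · b ≢ w → (∀ i → X i · b ∈ w ∷ W) → ∀ i → X i · b ∈ W
below {w} {W} w↑ {b} X₀b≢w N⊆ i with N⊆ 0F
... | here eq     = contradiction eq X₀b≢w
... | there X₀b∈ with N⊆ i
...   | there Xb∈ = Xb∈
...   | here eq with i Fin.≟ 0F
...     | yes refl = contradiction eq X₀b≢w
...     | no i≢0 = contradiction (proj₂ (All.lookup w↑ X₀b∈)) (<⇒≱ (begin
  suc (xdeg w)        ≡⟨ cong (suc ∘ xdeg) eq ⟨
  suc (xdeg (X i · b)) ≡⟨ cong suc (xdeg-X i b i≢0) ⟩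
  suc (xdeg b)        ≡⟨ xdeg-X₀ b ⟨
  xdeg (X 0F · b)     ∎))
  where open ≤-Reasoning

-- W is removed from the top downwards, so that the only downward-pointing triangle lost with w is
-- the one below it.  If it is b = w / x, then the triangles of the family covering y b and z b touch,
-- hence agree, and already contain w.
sweep : ∀ n W → AllPairs Above W → All (λ w → deg w ≡ n) W → ∀ {Bs} → Unique Bs →
  (∀ {b} → b ∈ Bs → ∀ i → X i · b ∈ W) →
  ∃ λ H → Family n H × Covers H W × Σ H (size n) + length Bs ≤ length W
sweep n []      _            _           {[]}     _  _   = [] , record { apart = [] ; nonzero = [] } , (λ ()) , z≤n
sweep n []      _            _           {b ∷ Bs} _  N⊆  = contradiction (N⊆ (here refl) 0F) λ ()
sweep n (w ∷ W) (w↑ ∷ above) (w≡n ∷ W≡n) {Bs}     B! N⊆ with Any.any? (λ b → X 0F · b ≟ w) Bs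
-- Removing `w` loses no triangle of `Bs`, so `w` may enter the family as a new triangle of side 1.
... | no none with sweep n W above W≡n B! (λ b∈ → below w↑ (λ eq → none (lose b∈ eq)) (N⊆ b∈))
...   | H , fam , covers , le with insert (length H) n H ≤-refl fam w (≤-reflexive w≡n)
...     | H′ , fam′ , covers′ , sizes = H′ , fam′ , covers″ , (begin
    Σ H′ (size n) + length Bs             ≤⟨ +-monoˡ-≤ (length Bs) sizes ⟩
    size n w + Σ H (size n) + length Bs   ≡⟨ +-assoc (size n w) _ _ ⟩
    size n w + (Σ H (size n) + length Bs) ≤⟨ +-mono-≤ (≤-reflexive size-w) le ⟩
    suc (length W)                        ∎)
  where
  open ≤-Reasoning
  size-w : size n w ≡ 1
  size-w = trans (cong (suc n ∸_) w≡n) (m+n∸n≡m 1 n)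
  covers″ : Covers H′ (w ∷ W)
  covers″ (here refl) = covers′ (here refl)
  covers″ (there v∈) with covers v∈
  ... | h , h∈ , h∣v with covers′ (there h∈)
  ...   | k , k∈ , k∣h = k , k∈ , ∣-trans k∣h h∣v
sweep n (w ∷ W) (w↑ ∷ above) (w≡n ∷ W≡n) {Bs} B! N⊆ | yes some with find some
-- `w` and `b` are dropped together, so the estimate persists with the same family; only the
-- covering of `w` remains to be shown.
... | b , b∈ , X₀b≡w with remove b∈
...   | Bs₁ , B↭ with Unique-resp-↭ B↭ B!
...     | b∉Bs₁ ∷ B₁! with sweep n W above W≡n B₁! (λ {b′} b′∈ → below w↑
                          (λ eq → All.lookup b∉Bs₁ b′∈ (X₀-injective (trans X₀b≡w (sym eq))))
                          (N⊆ (∈-resp-↭ (↭-sym B↭) (there b′∈))))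
...       | H , fam , covers , le = H , fam , covers′ , (begin
    Σ H (size n) + length Bs        ≡⟨ cong (_+_ (Σ H (size n))) (↭-length B↭) ⟩
    Σ H (size n) + suc (length Bs₁) ≡⟨ +-suc _ _ ⟩
    suc (Σ H (size n) + length Bs₁) ≤⟨ s≤s le ⟩
    suc (length W)                  ∎)
  where
  open ≤-Reasoning
  in-W : ∀ i → i ≢ 0F → X i · b ∈ W
  in-W i i≢0 with N⊆ b∈ i
  ... | there Xb∈ = Xb∈
  ... | here eq   = contradiction
    (trans (sym (xdeg-X i b i≢0)) (trans (cong xdeg (trans eq (sym X₀b≡w))) (xdeg-X₀ b))) (<⇒≢ (n<1+n _))
  covers′ : Covers H (w ∷ W)
  covers′ (there v∈) = covers v∈
  covers′ (here refl) with covers (in-W 1F λ ()) | covers (in-W 2F λ ())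
  ... | h , h∈ , h∣ | k , k∈ , k∣ = h , h∈ , subst (h ∣_) X₀b≡w (∣-trans
    (commonDivisor-X fam b (≤-reflexive (trans (sym (deg-X 0F b)) (trans (cong deg X₀b≡w) w≡n))) h∈ k∈ h∣ k∣)
    (∣-X 0F b))

-- The slope inequality

Σ-allFin : ∀ k (f : Fin (suc k) → ℕ) → Σ (allFin (suc k)) f ≡ f zero + Σ (allFin k) (f ∘ suc)
Σ-allFin k f = cong (_+_ (f zero)) (trans (cong (λ is → Σ is f) (sym (map-tabulate id suc))) (Σ-map suc (allFin k) f))

ΣOver : ∀ {k} → Subset k → (Fin k → ℕ) → ℕ
ΣOver {k} J f = Σ (allFin k) (λ i → if lookup J i then f i else 0)

∣∣≡ΣOver : ∀ {k} (J : Subset k) → ∣ J ∣ ≡ ΣOver J (λ _ → 1)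
∣∣≡ΣOver []          = refl
∣∣≡ΣOver (true ∷ J)  = trans (cong suc (∣∣≡ΣOver J)) (sym (Σ-allFin _ (λ i → if lookup (true ∷ J) i then 1 else 0)))
∣∣≡ΣOver (false ∷ J) = trans (∣∣≡ΣOver J) (sym (Σ-allFin _ (λ i → if lookup (false ∷ J) i then 1 else 0)))

ΣOver-mono : ∀ {k} (J : Subset k) {f g : Fin k → ℕ} → (∀ i → lookup J i ≡ true → f i ≤ g i) → ΣOver J f ≤ ΣOver J g
ΣOver-mono {k} J {f} {g} f≤g = Σ-mono (allFin k) (λ {i} _ → at i (lookup J i) refl)
  where
  at : ∀ i b → lookup J i ≡ b → (if b then f i else 0) ≤ (if b then g i else 0)
  at i true  eq = f≤g i eq
  at i false eq = z≤n

ΣOver-cong : ∀ {k} (J : Subset k) {f g : Fin k → ℕ} → (∀ i → lookup J i ≡ true → f i ≡ g i) → ΣOver J f ≡ ΣOver J g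
ΣOver-cong J f≡g = ≤-antisym (ΣOver-mono J (λ i i∈ → ≤-reflexive (f≡g i i∈)))
                             (ΣOver-mono J (λ i i∈ → ≤-reflexive (sym (f≡g i i∈))))

ΣOver-distrib-+ : ∀ {k} (J : Subset k) (f g : Fin k → ℕ) → ΣOver J (λ i → f i + g i) ≡ ΣOver J f + ΣOver J g
ΣOver-distrib-+ {k} J f g = trans (Σ-cong (allFin k) (λ {i} _ → at (lookup J i) i))
  (Σ-distrib-+ (allFin k) _ _)
  where
  at : ∀ b i → (if b then f i + g i else 0) ≡ (if b then f i else 0) + (if b then g i else 0)
  at true  i = refl
  at false i = refl

ΣOver-distribʳ-* : ∀ {k} (J : Subset k) (f : Fin k → ℕ) c → ΣOver J (λ i → f i * c) ≡ ΣOver J f * c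
ΣOver-distribʳ-* {k} J f c = trans (Σ-cong (allFin k) (λ {i} _ → at (lookup J i) i)) (Σ-distribʳ-* (allFin k) _ c)
  where
  at : ∀ b i → (if b then f i * c else 0) ≡ (if b then f i else 0) * c
  at true  i = refl
  at false i = refl

ΣOver-const : ∀ {k} (J : Subset k) c → ΣOver J (λ _ → c) ≡ ∣ J ∣ * c
ΣOver-const J c = begin
  ΣOver J (λ _ → c)      ≡⟨ ΣOver-cong J (λ _ _ → sym (+-identityʳ c)) ⟩
  ΣOver J (λ _ → 1 * c)  ≡⟨ ΣOver-distribʳ-* J (λ _ → 1) c ⟩
  ΣOver J (λ _ → 1) * c  ≡⟨ cong (_* c) (∣∣≡ΣOver J) ⟨
  ∣ J ∣ * c              ∎
  where open ≡-Reasoning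

ΣOver-⊆ : ∀ {k} (J : Subset k) (f : Fin k → ℕ) → ΣOver J f ≤ Σ (allFin k) f
ΣOver-⊆ {k} J f = Σ-mono (allFin k) (λ {i} _ → at (lookup J i) i)
  where
  at : ∀ b i → (if b then f i else 0) ≤ f i
  at true  i = ≤-refl
  at false i = z≤n

∣∣>0⇒∃∈ : ∀ {k} (J : Subset k) → 1 ≤ ∣ J ∣ → ∃ (_∈ˢ J)
∣∣>0⇒∃∈ J 1≤ with Fin.any? (_∈? J)
... | yes i∈ = i∈
... | no ¬i∈ = contradiction (≤-trans 1≤ (≤-trans (≤-reflexive (∣∣≡ΣOver J))
  (≤-trans (ΣOver-mono J {g = λ _ → 0} (λ i i∈ → contradiction (i , Vec.lookup⇒[]= i J i∈) ¬i∈))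
    (≤-reflexive (trans (ΣOver-const J 0) (*-zeroʳ ∣ J ∣)))))) λ ()

-- Quotients are normalised, so the comparison goes through unnormalised rationals, whose order is
-- cross-multiplication.
/-≤⁺ : ∀ c c′ a b .{{_ : NonZero a}} .{{_ : NonZero b}} → c ℤ.* ℤ.+ b ℤ.≤ c′ ℤ.* ℤ.+ a → (c /ℚ a) ≤ℚ (c′ /ℚ b)
/-≤⁺ c c′ (suc a) (suc b) le = ℚ.toℚᵘ-cancel-≤ (ℚᵘ.≤-trans (ℚᵘ.≤-reflexive (ℚ.toℚᵘ-fromℚᵘ (ℚᵘ.mkℚᵘ c a)))
  (ℚᵘ.≤-trans (ℚᵘ.*≤* le) (ℚᵘ.≤-reflexive (ℚᵘ.≃-sym (ℚ.toℚᵘ-fromℚᵘ (ℚᵘ.mkℚᵘ c′ b))))))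

/-≤⁻ : ∀ c c′ a b .{{_ : NonZero a}} .{{_ : NonZero b}} → (c /ℚ a) ≤ℚ (c′ /ℚ b) → c ℤ.* ℤ.+ b ℤ.≤ c′ ℤ.* ℤ.+ a
/-≤⁻ c c′ (suc a) (suc b) le = ℚᵘ.drop-*≤* (ℚᵘ.≤-trans (ℚᵘ.≤-reflexive (ℚᵘ.≃-sym (ℚ.toℚᵘ-fromℚᵘ (ℚᵘ.mkℚᵘ c a))))
  (ℚᵘ.≤-trans (ℚ.toℚᵘ-mono-≤ le) (ℚᵘ.≤-reflexive (ℚ.toℚᵘ-fromℚᵘ (ℚᵘ.mkℚᵘ c′ b)))))

slope-difference : ∀ h A B K M →
  (ℤ.- (ℤ.+ B)) ℤ.* ℤ.+ K ℤ.- (ℤ.+ h ℤ.- ℤ.+ A) ℤ.* ℤ.+ M ≡ ℤ.+ (A * M) ℤ.- ℤ.+ (h * M + B * K)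
slope-difference h A B K M = begin
  (ℤ.- (ℤ.+ B)) ℤ.* ℤ.+ K ℤ.- (ℤ.+ h ℤ.- ℤ.+ A) ℤ.* ℤ.+ M
    ≡⟨ expand (ℤ.+ h) (ℤ.+ A) (ℤ.+ B) (ℤ.+ K) (ℤ.+ M) ⟩
  ℤ.+ A ℤ.* ℤ.+ M ℤ.- (ℤ.+ h ℤ.* ℤ.+ M ℤ.+ ℤ.+ B ℤ.* ℤ.+ K)
    ≡⟨ cong₂ ℤ._-_ (ℤ.pos-* A M) (trans (ℤ.pos-+ (h * M) (B * K)) (cong₂ ℤ._+_ (ℤ.pos-* h M) (ℤ.pos-* B K))) ⟨
  ℤ.+ (A * M) ℤ.- ℤ.+ (h * M + B * K) ∎
  where
  open ≡-Reasoning
  expand : ∀ h A B K M → (ℤ.- B) ℤ.* K ℤ.- (h ℤ.- A) ℤ.* M ≡ A ℤ.* M ℤ.- (h ℤ.* M ℤ.+ B ℤ.* K)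
  expand = ℤ-solve-∀

-- The slope inequality for a set of K + 1 out of M + 1 generators, where A, B are the sums of degrees
-- and s, S those of the sides of the punctures.
module _ {h A B s S D : ℕ} (d K M : ℕ) (h+D : h + D ≡ d) (A+s : A + s ≡ suc K * d) (B+S : B + S ≡ suc M * d) where

  private
    -- Adding `s * M + (D * M + S * K)` to either side of the inequality between degrees leaves the
    -- common term `d * M + M * d * K` plus one side of the inequality between sides.
    lhs : (h * M + B * K) + (s * M + (D * M + S * K)) ≡ (d * M + M * d * K) + (s * M + d * K)
    lhs = trans (collect h M B K s D S) (trans (cong₂ (λ a b → a * M + b * K + s * M) h+D B+S) (expand d M K s))
      where
      collect : ∀ h M B K s D S → (h * M + B * K) + (s * M + (D * M + S * K)) ≡ (h + D) * M + (B + S) * K + s * M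
      collect = solve-∀
      expand : ∀ d M K s → d * M + suc M * d * K + s * M ≡ (d * M + M * d * K) + (s * M + d * K)
      expand = solve-∀
    rhs : A * M + (s * M + (D * M + S * K)) ≡ (d * M + M * d * K) + (D * M + S * K)
    rhs = trans (collect A s M (D * M + S * K)) (trans (cong (λ a → a * M + (D * M + S * K)) A+s) (expand d M K (D * M + S * K)))
      where
      collect : ∀ A s M e → A * M + (s * M + e) ≡ (A + s) * M + e
      collect = solve-∀
      expand : ∀ d M K e → suc K * d * M + e ≡ (d * M + M * d * K) + e
      expand = solve-∀

  -- In terms of sides the slope inequality is (s - D) M ≤ (S - d) K, written without subtraction.
  -- The factor S - d is the over-puncturing coefficient.
  slope-≤⁺ : s * M + d * K ≤ D * M + S * K →
    (ℤ.+ h ℤ.- ℤ.+ A) ℤ.* ℤ.+ M ℤ.≤ (ℤ.- (ℤ.+ B)) ℤ.* ℤ.+ K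
  slope-≤⁺ le = ℤ.0≤i-j⇒j≤i (subst (0ℤ ℤ.≤_) (sym (slope-difference h A B K M)) (ℤ.i≤j⇒0≤j-i (ℤ.+≤+
    (+-cancelʳ-≤ (s * M + (D * M + S * K)) (h * M + B * K) (A * M)
      (≤-trans (≤-reflexive lhs) (≤-trans (+-monoʳ-≤ (d * M + M * d * K) le) (≤-reflexive (sym rhs))))))))

  slope-≤⁻ : (ℤ.+ h ℤ.- ℤ.+ A) ℤ.* ℤ.+ M ℤ.≤ (ℤ.- (ℤ.+ B)) ℤ.* ℤ.+ K →
    s * M + d * K ≤ D * M + S * K
  slope-≤⁻ le = +-cancelˡ-≤ (d * M + M * d * K) _ _ (≤-trans (≤-reflexive (sym lhs)) (≤-trans
    (+-monoˡ-≤ (s * M + (D * M + S * K)) (ℤ.drop‿+≤+ (ℤ.0≤i-j⇒j≤i {ℤ.+ (A * M)} {ℤ.+ (h * M + B * K)} (subst (0ℤ ℤ.≤_) (slope-difference h A B K M)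
      (ℤ.i≤j⇒0≤j-i le))))) (≤-reflexive rhs)))

-- The punctures of a triangle

module Punctured (I : MonomialIdeal) (n : ℕ) (bound : ∀ i → deg (gen I i) ≤ suc n) where

  indices : List (Fin (m I))
  indices = allFin (m I)

  length-indices : length indices ≡ m I
  length-indices = length-tabulate (id {A = Fin (m I)})

  side : Fin (m I) → ℕ
  side i = size n (gen I i)

  sides : ℕ
  sides = Σ indices side

  deg+side : ∀ i → deg (gen I i) + side i ≡ suc n
  deg+side i = m+[n∸m]≡n (bound i)

  member? : ∀ u → Dec (⟨ I ⟩ u)
  member? u = Fin.any? (λ i → gen I i ∣? u)

  member-∣ : ∀ {u v} → ⟨ I ⟩ u → u ∣ v → ⟨ I ⟩ v
  member-∣ (i , g∣u) u∣v = i , ∣-trans g∣u u∣v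

  △Inside ▽Inside △Outside ▽Outside : List Monomial
  △Inside  = filter member? (monomials n)
  ▽Inside  = filter member? (monomials⁻ n)
  △Outside = filter (¬? ∘ member?) (monomials n)
  ▽Outside = filter (¬? ∘ member?) (monomials⁻ n)

  -- The excess measures overlaps: it counts coverings beyond the first, and truncation makes it 0
  -- outside all punctures too.
  multiplicity excess : Monomial → ℕ
  multiplicity u = Σ indices (λ i → 𝟙 (gen I i ∣? u))
  excess u       = multiplicity u ∸ 1

  multiplicity≡ : ∀ u → multiplicity u ≡ 𝟙 (member? u) + excess u
  multiplicity≡ u with member? u
  ... | yes (i , g∣u) = sym (m+[n∸m]≡n (≤-trans (≤-reflexive (sym (𝟙-true (gen I i ∣? u) g∣u)))
                          (Σ-≥ indices (λ i → 𝟙 (gen I i ∣? u)) (∈-allFin i))))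
  ... | no u∉ = trans none (sym (cong (_∸ 1) none))
    where
    none : multiplicity u ≡ 0
    none = trans (Σ-cong indices {g = λ _ → 0} (λ {i} _ → 𝟙-false (gen I i ∣? u) (λ g∣u → u∉ (i , g∣u))))
             (trans (Σ-const indices 0) (*-zeroʳ (length indices)))

  multiplicity-mono : ∀ {u v} → u ∣ v → multiplicity u ≤ multiplicity v
  multiplicity-mono {u} {v} u∣v =
    Σ-mono indices (λ {i} _ → 𝟙-mono (gen I i ∣? u) (gen I i ∣? v) (λ g∣u → ∣-trans g∣u u∣v))

  excess-X : ∀ i b → excess b ≤ excess (X i · b)
  excess-X i b = ∸-monoˡ-≤ 1 (multiplicity-mono (∣-X i b))

  -- Pairs of a puncture and a unit triangle in it are counted in two ways, with `countMultiples`
  -- applied to each puncture.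
  inside-count : length △Inside + Σ (monomials n) excess ≡ length ▽Inside + Σ (monomials⁻ n) excess + sides
  inside-count = begin
    length △Inside + Σ (monomials n) excess
      ≡⟨ split (monomials n) ⟩
    Σ (monomials n) multiplicity
      ≡⟨ Σ-comm (monomials n) indices (λ u i → 𝟙 (gen I i ∣? u)) ⟩
    Σ indices (λ i → Σ (monomials n) (λ u → 𝟙 (gen I i ∣? u)))
      ≡⟨ Σ-cong indices (λ {i} _ → countMultiples n (gen I i)) ⟩
    Σ indices (λ i → Σ (monomials⁻ n) (λ u → 𝟙 (gen I i ∣? u)) + side i)
      ≡⟨ Σ-distrib-+ indices _ side ⟩
    Σ indices (λ i → Σ (monomials⁻ n) (λ u → 𝟙 (gen I i ∣? u))) + sides
      ≡⟨ cong (_+ sides) (Σ-comm (monomials⁻ n) indices (λ u i → 𝟙 (gen I i ∣? u))) ⟨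
    Σ (monomials⁻ n) multiplicity + sides
      ≡⟨ cong (_+ sides) (split (monomials⁻ n)) ⟨
    length ▽Inside + Σ (monomials⁻ n) excess + sides ∎
    where
    open ≡-Reasoning
    split : ∀ L → length (filter member? L) + Σ L excess ≡ Σ L multiplicity
    split L = trans (cong (_+ Σ L excess) (length-filter-Σ member? L))
      (trans (sym (Σ-distrib-+ L (𝟙 ∘ member?) excess)) (Σ-cong L (λ {u} _ → sym (multiplicity≡ u))))

  excess-≤ : Σ (monomials⁻ n) excess ≤ Σ (monomials n) excess
  excess-≤ = Σ-monomials⁻-≤ n (excess-X 0F)

  -- Overlaps weigh at least as much on upward- as on downward-pointing triangles, so they can only
  -- lower the surplus.
  △Inside≤ : length △Inside ≤ length ▽Inside + sides
  △Inside≤ = +-cancelʳ-≤ (Σ (monomials n) excess) _ _ (begin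
    length △Inside + Σ (monomials n) excess            ≡⟨ inside-count ⟩
    length ▽Inside + Σ (monomials⁻ n) excess + sides   ≤⟨ +-monoˡ-≤ sides (+-monoʳ-≤ (length ▽Inside) excess-≤) ⟩
    length ▽Inside + Σ (monomials n) excess + sides    ≡⟨ swap (length ▽Inside) (Σ (monomials n) excess) sides ⟩
    length ▽Inside + sides + Σ (monomials n) excess    ∎)
    where
    open ≤-Reasoning
    swap : ∀ a b c → a + b + c ≡ a + c + b
    swap = solve-∀

  -- The multiples of `𝟏` fill the whole triangle, of side n + 1.
  △≡▽+ : length (monomials n) ≡ length (monomials⁻ n) + suc n
  △≡▽+ = begin
    length (monomials n)                                   ≡⟨ ones (monomials n) ⟨
    Σ (monomials n) (λ u → 𝟙 (𝟏 ∣? u))                     ≡⟨ countMultiples n 𝟏 ⟩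
    Σ (monomials⁻ n) (λ u → 𝟙 (𝟏 ∣? u)) + suc n            ≡⟨ cong (_+ suc n) (ones (monomials⁻ n)) ⟩
    length (monomials⁻ n) + suc n                          ∎
    where
    open ≡-Reasoning
    ones : ∀ L → Σ L (λ u → 𝟙 (𝟏 ∣? u)) ≡ length L
    ones L = trans (Σ-cong L (λ {u} _ → 𝟙-true (𝟏 ∣? u) (𝟏∣ u))) (trans (Σ-const L 1) (*-identityʳ _))

  inside-outside : length △Inside + length △Outside ≡ length ▽Inside + length ▽Outside + suc n
  inside-outside = trans (length-filter-¬ member? (monomials n))
    (trans △≡▽+ (cong (_+ suc n) (sym (length-filter-¬ member? (monomials⁻ n)))))

  degSum≡ : ∀ J → degSum I J ≡ ℤ.+ ΣOver J (deg ∘ gen I)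
  degSum≡ J = trans (sum-cong-≗ {m I} (λ i → at (lookup J i) i))
    (∑≡Σ (m I) (λ i → if lookup J i then deg (gen I i) else 0))
    where
    at : ∀ b i → (if b then ℤ.+ deg (gen I i) else 0ℤ) ≡ ℤ.+ (if b then deg (gen I i) else 0)
    at true  i = refl
    at false i = refl

  ΣOver-deg+side : ∀ J → ΣOver J (deg ∘ gen I) + ΣOver J side ≡ ∣ J ∣ * suc n
  ΣOver-deg+side J = trans (sym (ΣOver-distrib-+ J (deg ∘ gen I) side))
    (trans (ΣOver-cong J (λ i _ → deg+side i)) (ΣOver-const J (suc n)))

  Σ-deg+side : Σ indices (deg ∘ gen I) + sides ≡ m I * suc n
  Σ-deg+side = trans (sym (Σ-distrib-+ indices (deg ∘ gen I) side)) (trans (Σ-cong indices (λ {i} _ → deg+side i))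
    (trans (Σ-const indices (suc n)) (cong (_* suc n) (length-indices))))

  overPuncturing≡ : overPuncturing (suc n) I ≡ ℤ.+ sides ℤ.- ℤ.+ suc n
  overPuncturing≡ = cong (ℤ._- ℤ.+ suc n) (trans
    (sum-cong-≗ {m I} (λ i → trans (ℤ.m-n≡m⊖n (suc n) (deg (gen I i))) (ℤ.⊖-≥ (bound i))))
    (∑≡Σ (m I) side))

  perfectlyPunctured⇒ : PerfectlyPunctured (suc n) I → sides ≡ suc n
  perfectlyPunctured⇒ pp = ℤ.+-injective (ℤ.i-j≡0⇒i≡j _ _ (trans (sym overPuncturing≡) pp))

  perfectlyPunctured⇐ : sides ≡ suc n → PerfectlyPunctured (suc n) I
  perfectlyPunctured⇐ eq = trans overPuncturing≡ (ℤ.i≡j⇒i-j≡0 (cong ℤ.+_ eq))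

  commonDivisor-exists : ∀ i is → ∃ λ h → (∀ {j} → j ∈ i ∷ is → h ∣ gen I j) ×
    (∀ {h′} → (∀ {j} → j ∈ i ∷ is → h′ ∣ gen I j) → h′ ∣ h)
  commonDivisor-exists i []       = gen I i , (λ { (here refl) → ∣-refl }) , λ h′∣ → h′∣ (here refl)
  commonDivisor-exists i (k ∷ is) with commonDivisor-exists k is
  ... | h , h∣ , greatest = gcd (gen I i) h ,
    (λ { (here refl) → gcd∣ˡ (gen I i) h ; (there j∈) → ∣-trans (gcd∣ʳ (gen I i) h) (h∣ j∈) }) ,
    λ h′∣ → gcd-greatest (h′∣ (here refl)) (greatest (h′∣ ∘ there))

  isGCD-exists : ∀ J {i} → i ∈ˢ J → ∃ (IsGCD I J)
  -- `i` is repeated in front of the elements of `J` to make the list visibly non-empty.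
  isGCD-exists J {i} i∈J with commonDivisor-exists i (filter (_∈? J) indices)
  ... | h , h∣ , greatest = h , record
    { commonDivisor = λ {j} j∈J → h∣ (there (∈-filter⁺ (_∈? J) (∈-allFin j) j∈J))
    ; greatest = λ h′∣ → greatest λ { (here refl) → h′∣ i∈J ; (there j∈) → h′∣ (proj₂ (∈-filter⁻ (_∈? J) {xs = indices} j∈)) } }

  slopeInequality : ∀ J → 2 ≤ ∣ J ∣ → Monomial → Set
  slopeInequality J 2≤ h =
    ((ℤ.+ deg h ℤ.- degSum I J) /pred 2≤) ≤ℚ ((ℤ.- (∑[ i < m I ] (ℤ.+ deg (gen I i)))) /pred ≤-trans 2≤ (∣p∣≤n J))

  module _ (J : Subset (m I)) (2≤ : 2 ≤ ∣ J ∣) (h : Monomial) (h≤ : deg h ≤ suc n) where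

    private
      K = ∣ J ∣ ∸ 1
      M = m I ∸ 1
      instance
        K-nonZero : NonZero K
        K-nonZero = >-nonZero (m<n⇒0<n∸m 2≤)
        M-nonZero : NonZero M
        M-nonZero = >-nonZero (m<n⇒0<n∸m (≤-trans 2≤ (∣p∣≤n J)))
      1+K : suc K ≡ ∣ J ∣
      1+K = m+[n∸m]≡n (≤-trans (n≤1+n 1) 2≤)
      1+M : suc M ≡ m I
      1+M = m+[n∸m]≡n (≤-trans (≤-trans (n≤1+n 1) 2≤) (∣p∣≤n J))
      c c′ C C′ : ℤ
      c  = ℤ.+ deg h ℤ.- degSum I J
      c′ = ℤ.- (∑[ i < m I ] (ℤ.+ deg (gen I i)))
      C  = ℤ.+ deg h ℤ.- ℤ.+ ΣOver J (deg ∘ gen I)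
      C′ = ℤ.- (ℤ.+ Σ indices (deg ∘ gen I))
      c≡C : c ≡ C
      c≡C = cong (λ a → ℤ.+ deg h ℤ.- a) (degSum≡ J)
      c′≡C′ : c′ ≡ C′
      c′≡C′ = cong ℤ.-_ (∑≡Σ (m I) (deg ∘ gen I))
      h+D : deg h + size n h ≡ suc n
      h+D = m+[n∸m]≡n h≤
      A+s : ΣOver J (deg ∘ gen I) + ΣOver J side ≡ suc K * suc n
      A+s = trans (ΣOver-deg+side J) (cong (_* suc n) (sym 1+K))
      B+S : Σ indices (deg ∘ gen I) + sides ≡ suc M * suc n
      B+S = trans Σ-deg+side (cong (_* suc n) (sym 1+M))

    slopeInequality⁺ : ΣOver J side * M + suc n * K ≤ size n h * M + sides * K → slopeInequality J 2≤ h
    slopeInequality⁺ le = /-≤⁺ c c′ K M (subst₂ (λ a a′ → a ℤ.* ℤ.+ M ℤ.≤ a′ ℤ.* ℤ.+ K) (sym c≡C) (sym c′≡C′)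
      (slope-≤⁺ {deg h} {ΣOver J (deg ∘ gen I)} {Σ indices (deg ∘ gen I)} {ΣOver J side} {sides} {size n h} (suc n) K M h+D A+s B+S le))

    slopeInequality⁻ : slopeInequality J 2≤ h → ΣOver J side * M + suc n * K ≤ size n h * M + sides * K
    slopeInequality⁻ le = slope-≤⁻ {deg h} {ΣOver J (deg ∘ gen I)} {Σ indices (deg ∘ gen I)} {ΣOver J side} {sides} {size n h} (suc n) K M h+D A+s B+S
      (subst₂ (λ a a′ → a ℤ.* ℤ.+ M ℤ.≤ a′ ℤ.* ℤ.+ K) c≡C c′≡C′ (/-≤⁻ c c′ K M le))

  ΣOver-side-≤ : ∀ J h → (∀ i → i ∈ˢ J → h ∣ gen I i) → ΣOver J side ≤ ∣ J ∣ * size n h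
  ΣOver-side-≤ J h h∣ = ≤-trans
    (ΣOver-mono J (λ i i∈J → size-mono n (h∣ i (Vec.lookup⇒[]= i J i∈J))))
    (≤-reflexive (ΣOver-const J (size n h)))

  generators-covered : ∀ {H W} → Family n H → Covers H W → (∀ {i u} → gen I i ∣ u → deg u ≡ n → u ∈ W) →
    ∀ i → 1 ≤ side i → ∃ λ h → h ∈ H × h ∣ gen I i
  generators-covered {H} {W} fam covers inside⊆ i 1≤ = covers-divisor fam covers (n ∸ deg (gen I i)) (gen I i)
    (m+[n∸m]≡n (s≤s⁻¹ (m∸n≢0⇒n<m {suc n} {deg (gen I i)} (≢-sym (<⇒≢ 1≤))))) (λ degu g∣u → inside⊆ g∣u degu)

  X-∈-inside : ∀ {b} → b ∈ ▽Inside → ∀ i → X i · b ∈ △Inside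
  X-∈-inside {b} b∈ i with ∈-filter⁻ member? {xs = monomials⁻ n} b∈
  ... | b∈L , b∈I = ∈-filter⁺ member? (∈-monomials⁺ (trans (deg-X i b) (∈-monomials⁻⁻ n b∈L))) (member-∣ b∈I (∣-X i b))

  -- `o` is the over-puncturing coefficient. It is 0 when tilings are constructed and positive in
  -- the final contradiction.
  module Semistable (ss : SyzygyBundleSemistable I) (2≤m : 2 ≤ m I)
    (coprime : ∀ {h} → (∀ i → h ∣ gen I i) → deg h ≡ 0) (o : ℕ) (sides≡ : sides ≡ suc n + o) where

    M : ℕ
    M = m I ∸ 1

    m≡1+M : m I ≡ suc M
    m≡1+M = sym (m+[n∸m]≡n (≤-trans (n≤1+n 1) 2≤m))

    -- For J = ⊤, where semistability says nothing, this is an equality.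
    side-bound : ∀ J h → (∀ i → i ∈ˢ J → h ∣ gen I i) → ΣOver J side * M ≤ size n h * M + o * (∣ J ∣ ∸ 1)
    side-bound J h h∣ with 2 ≤? ∣ J ∣
    -- For at most one element this is the monotonicity of sides under divisibility.
    ... | no 2≰ = ≤-trans (*-monoˡ-≤ M (≤-trans (ΣOver-side-≤ J h h∣)
            (≤-trans (*-monoˡ-≤ (size n h) (s≤s⁻¹ (≰⇒> 2≰))) (≤-reflexive (*-identityˡ _))))) (m≤m+n _ _)
    ... | yes 2≤ with Fin.all? (_∈? J)
    ...   | yes all∈ = begin
      ΣOver J side * M                          ≤⟨ *-monoˡ-≤ M (ΣOver-⊆ J side) ⟩
      sides * M                                 ≡⟨ cong (_* M) sides≡ ⟩
      (suc n + o) * M                           ≡⟨ *-distribʳ-+ M (suc n) o ⟩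
      suc n * M + o * M                         ≤⟨ +-mono-≤
                                                     (*-monoˡ-≤ M (≤-reflexive (cong (suc n ∸_) (sym (coprime (λ i → h∣ i (all∈ i)))))))
                                                     (*-monoʳ-≤ o (≤-reflexive (cong (_∸ 1) m≡∣J∣))) ⟩
      size n h * M + o * (∣ J ∣ ∸ 1)            ∎
      where
      open ≤-Reasoning
      m≡∣J∣ : m I ≡ ∣ J ∣
      m≡∣J∣ = ≤-antisym (begin
        m I                            ≡⟨ trans (Σ-const indices 1) (trans (*-identityʳ _) (length-indices)) ⟨
        Σ indices (λ _ → 1)            ≤⟨ Σ-mono indices (λ {i} _ → ≤-reflexive (cong (λ b → if b then 1 else 0) (sym (Vec.[]=⇒lookup (all∈ i))))) ⟩
        ΣOver J (λ _ → 1)              ≡⟨ ∣∣≡ΣOver J ⟨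
        ∣ J ∣                          ∎) (∣p∣≤n J)
    ...   | no ¬all with Fin.¬∀⟶∃¬ (m I) (_∈ˢ J) (_∈? J) ¬all
    -- Semistability speaks of the gcd `h₀` of `J`; its triangle lies inside that of `h`.
    ...     | k , k∉J = +-cancelʳ-≤ (suc n * (∣ J ∣ ∸ 1)) _ _ (begin
      ΣOver J side * M + suc n * (∣ J ∣ ∸ 1)                     ≤⟨ slopeInequality⁻ J 2≤ h₀ h₀≤ (ss J J⊂⊤ 2≤ h₀ isGCD) ⟩
      size n h₀ * M + sides * (∣ J ∣ ∸ 1)                        ≡⟨ cong (λ s → size n h₀ * M + s * (∣ J ∣ ∸ 1)) sides≡ ⟩
      size n h₀ * M + (suc n + o) * (∣ J ∣ ∸ 1)                  ≤⟨ +-monoˡ-≤ _ (*-monoˡ-≤ M (size-mono n h∣h₀)) ⟩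
      size n h * M + (suc n + o) * (∣ J ∣ ∸ 1)                   ≡⟨ expand (size n h * M) (suc n) o (∣ J ∣ ∸ 1) ⟩
      size n h * M + o * (∣ J ∣ ∸ 1) + suc n * (∣ J ∣ ∸ 1)       ∎)
      where
      open ≤-Reasoning
      expand : ∀ a b c k → a + (b + c) * k ≡ a + c * k + b * k
      expand = solve-∀
      J⊂⊤ : J ⊂ ⊤
      J⊂⊤ = (λ _ → ∈⊤) , k , ∈⊤ , k∉J
      inhabited : ∃ (_∈ˢ J)
      inhabited = ∣∣>0⇒∃∈ J (≤-trans (n≤1+n 1) 2≤)
      h₀ : Monomial
      h₀ = proj₁ (isGCD-exists J (proj₂ inhabited))
      isGCD : IsGCD I J h₀
      isGCD = proj₂ (isGCD-exists J (proj₂ inhabited))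
      h∣h₀ : h ∣ h₀
      h∣h₀ = IsGCD.greatest isGCD (λ {j} → h∣ j)
      h₀≤ : deg h₀ ≤ suc n
      h₀≤ = ≤-trans (deg-mono (IsGCD.commonDivisor isGCD (proj₂ inhabited))) (bound (proj₁ inhabited))

    -- For non-empty `J`, `side-bound` says that the numbers side i * M - o have a sum of at most
    -- the same expression for the enclosing triangle. This makes them additive charges.
    weight : Fin (m I) → ℕ
    weight i = side i * M ∸ o

    -- Subtracting o for each of the M + 1 generators takes away o M + o, and the surplus o in
    -- `sides≡` gives back o M. `c` records a gain from truncation.
    weights-≥+ : ∀ {c} → Σ indices (λ i → side i * M) + c ≤ Σ indices (λ i → weight i + o) →
      suc n * M + c ≤ Σ indices weight + o
    weights-≥+ {c} le = +-cancelʳ-≤ (o * M) _ _ (begin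
      suc n * M + c + o * M                        ≡⟨ swap (suc n * M) c (o * M) ⟩
      suc n * M + o * M + c                        ≡⟨ cong (_+ c) (trans (cong (_* M) sides≡) (*-distribʳ-+ M (suc n) o)) ⟨
      sides * M + c                                ≡⟨ cong (_+ c) (Σ-distribʳ-* indices side M) ⟨
      Σ indices (λ i → side i * M) + c             ≤⟨ le ⟩
      Σ indices (λ i → weight i + o)               ≡⟨ Σ-distrib-+ indices weight (λ _ → o) ⟩
      Σ indices weight + Σ indices (λ _ → o)       ≡⟨ cong (_+_ (Σ indices weight)) (trans (Σ-const indices o) (cong (_* o) (trans length-indices m≡1+M))) ⟩
      Σ indices weight + suc M * o                 ≡⟨ rearrange (Σ indices weight) M o ⟩
      Σ indices weight + o + o * M                 ∎)
      where
      open ≤-Reasoning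
      swap : ∀ a b c → a + b + c ≡ a + c + b
      swap = solve-∀
      rearrange : ∀ w M o → w + suc M * o ≡ w + o + o * M
      rearrange = solve-∀

    weight+o-≥ : ∀ i → side i * M ≤ weight i + o
    weight+o-≥ i = ≤-trans (m≤n+m∸n (side i * M) o) (≤-reflexive (+-comm o (weight i)))

    weights-≥ : suc n * M ≤ Σ indices weight + o
    weights-≥ = ≤-trans (≤-reflexive (sym (+-identityʳ _)))
      (weights-≥+ (≤-trans (≤-reflexive (+-identityʳ _)) (Σ-mono indices (λ {i} _ → weight+o-≥ i))))

    -- For side 0, truncation makes the weight exceed side i * M - o by o.
    weights-≥′ : ∀ {i} → side i ≡ 0 → suc n * M ≤ Σ indices weight
    weights-≥′ {i} side≡0 = +-cancelʳ-≤ o _ _ (weights-≥+ (Σ-mono-at indices (λ {i} _ → weight+o-≥ i) (∈-allFin i)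
      (≤-trans (≤-reflexive (cong (λ s → s * M + o) side≡0)) (m≤n+m o (weight i)))))

    heavyMultiple? : ∀ h i → Dec (h ∣ gen I i × o ≤ side i * M)
    heavyMultiple? h i = (h ∣? gen I i) ×-dec (o ≤? side i * M)

    -- Restricted to generators whose weight is not truncated, so that `weight i + o` is exactly
    -- `side i * M`; all others have weight 0.
    heavyMultiples : Monomial → Subset (m I)
    heavyMultiples h = Vec.tabulate (λ i → does (heavyMultiple? h i))

    ∈-heavyMultiples⁻ : ∀ h i → lookup (heavyMultiples h) i ≡ true → h ∣ gen I i × o ≤ side i * M
    ∈-heavyMultiples⁻ h i eq = does-true (heavyMultiple? h i) (trans (sym (Vec.lookup∘tabulate (does ∘ heavyMultiple? h) i)) eq)
      where
      does-true : {P : Set} (p : Dec P) → does p ≡ true → P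
      does-true (yes p) _ = p

    ∈-heavyMultiples⁺ : ∀ h i → h ∣ gen I i → o ≤ side i * M → lookup (heavyMultiples h) i ≡ true
    ∈-heavyMultiples⁺ h i h∣ o≤ = trans (Vec.lookup∘tabulate (does ∘ heavyMultiple? h) i)
      (dec-true (heavyMultiple? h i) (h∣ , o≤))

    -- Among K + 1 heavy generators o is subtracted K + 1 times, and `side-bound` uses up K of
    -- these; one remains on the right.
    weight-bound : ∀ h → ΣOver (heavyMultiples h) weight ≤ size n h * M ∸ o
    weight-bound h with ∣ heavyMultiples h ∣ in ∣J∣≡
    ... | zero = ≤-trans (ΣOver-mono J {g = λ _ → size n h * M} (λ i i∈ → ≤-trans (m∸n≤m (side i * M) o)
                    (*-monoˡ-≤ M (size-mono n (proj₁ (∈-heavyMultiples⁻ h i i∈))))))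
                  (≤-trans (≤-reflexive (trans (ΣOver-const J (size n h * M)) (cong (_* (size n h * M)) ∣J∣≡))) z≤n)
      where
      J = heavyMultiples h
    ... | suc K = m+n≤o⇒m≤o∸n (ΣOver J weight) (+-cancelʳ-≤ (o * K) _ _ (begin
      ΣOver J weight + o + o * K               ≡⟨ rearrange (ΣOver J weight) o K ⟩
      ΣOver J weight + suc K * o               ≡⟨ cong (λ k → ΣOver J weight + k * o) ∣J∣≡ ⟨
      ΣOver J weight + ∣ J ∣ * o               ≡⟨ cong (_+_ (ΣOver J weight)) (ΣOver-const J o) ⟨
      ΣOver J weight + ΣOver J (λ _ → o)       ≡⟨ ΣOver-distrib-+ J weight (λ _ → o) ⟨
      ΣOver J (λ i → weight i + o)             ≡⟨ ΣOver-cong J (λ i i∈ → m∸n+n≡m (proj₂ (∈-heavyMultiples⁻ h i i∈))) ⟩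
      ΣOver J (λ i → side i * M)               ≡⟨ ΣOver-distribʳ-* J side M ⟩
      ΣOver J side * M                         ≤⟨ side-bound J h (λ i i∈ → proj₁ (∈-heavyMultiples⁻ h i (Vec.[]=⇒lookup i∈))) ⟩
      size n h * M + o * (∣ J ∣ ∸ 1)           ≡⟨ cong (λ k → size n h * M + o * (k ∸ 1)) ∣J∣≡ ⟩
      size n h * M + o * K                     ∎))
      where
      open ≤-Reasoning
      J = heavyMultiples h
      rearrange : ∀ w o K → w + o + o * K ≡ w + suc K * o
      rearrange = solve-∀

    -- Each generator of positive weight is charged to the triangles of `H` containing it, of which
    -- there is one; then the order of summation is exchanged.
    weights-≤ : ∀ H → (∀ i → 1 ≤ side i → ∃ λ h → h ∈ H × h ∣ gen I i) →
      Σ indices weight ≤ Σ H (λ h → size n h * M ∸ o)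
    weights-≤ H covered = begin
      Σ indices weight
        ≤⟨ Σ-mono indices (λ {i} _ → cover i) ⟩
      Σ indices (λ i → Σ H (λ h → if lookup (heavyMultiples h) i then weight i else 0))
        ≡⟨ Σ-comm indices H _ ⟩
      Σ H (λ h → ΣOver (heavyMultiples h) weight)
        ≤⟨ Σ-mono H (λ {h} _ → weight-bound h) ⟩
      Σ H (λ h → size n h * M ∸ o) ∎
      where
      open ≤-Reasoning
      cover : ∀ i → weight i ≤ Σ H (λ h → if lookup (heavyMultiples h) i then weight i else 0)
      cover i with o ≤? side i * M | 1 ≤? side i
      ... | no o≰ | _ = ≤-trans (≤-reflexive (m≤n⇒m∸n≡0 (<⇒≤ (≰⇒> o≰)))) z≤n
      ... | yes _ | no 1≰ = ≤-trans (≤-reflexive (trans (cong (λ s → s * M ∸ o) (n≤0⇒n≡0 (s≤s⁻¹ (≰⇒> 1≰)))) (0∸n≡0 o))) z≤n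
      ... | yes o≤ | yes 1≤ with covered i 1≤
      ...   | h , h∈ , h∣ = begin
        weight i
          ≡⟨ cong (λ b → if b then weight i else 0) (∈-heavyMultiples⁺ h i h∣ o≤) ⟨
        (if lookup (heavyMultiples h) i then weight i else 0)
          ≤⟨ Σ-≥ H (λ h → if lookup (heavyMultiples h) i then weight i else 0) h∈ ⟩
        Σ H (λ h → if lookup (heavyMultiples h) i then weight i else 0) ∎

-- Counting with a tiling

module Tilings (I : MonomialIdeal) (n : ℕ) (bound : ∀ i → deg (gen I i) ≤ suc n) where

  open Punctured I n bound

  OutsideMultiple : Monomial → Pred Monomial _
  OutsideMultiple h u = h ∣ u × ¬ ⟨ I ⟩ u

  outsideMultiple? : ∀ h → Decidable (OutsideMultiple h)
  outsideMultiple? h u = (h ∣? u) ×-dec ¬? (member? u)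

  module Tiling (ℓs : List Lozenge) (partition : IsPartition (T (suc n) I) ℓs) where

    open IsPartition partition
    open Lozenge

    Tile : Monomial → Monomial → Set
    Tile b u = ∃ λ ℓ → ℓ ∈ ℓs × down ℓ ≡ b × up ℓ ≡ u

    lozenge-unique : ∀ {ℓs ℓ ℓ′ t} → AllPairs (λ ℓ ℓ′ → ∀ {t} → ¬ (⟦ ℓ ⟧ t × ⟦ ℓ′ ⟧ t)) ℓs →
      ℓ ∈ ℓs → ℓ′ ∈ ℓs → ⟦ ℓ ⟧ t → ⟦ ℓ′ ⟧ t → ℓ ≡ ℓ′
    lozenge-unique (_ ∷ _)    (here refl) (here refl) _ _   = refl
    lozenge-unique (ap ∷ _)   (here refl) (there ℓ′∈) t∈ t∈′ = contradiction (t∈ , t∈′) (All.lookup ap ℓ′∈)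
    lozenge-unique (ap ∷ _)   (there ℓ∈)  (here refl) t∈ t∈′ = contradiction (t∈′ , t∈) (All.lookup ap ℓ∈)
    lozenge-unique (_ ∷ aps)  (there ℓ∈)  (there ℓ′∈) t∈ t∈′ = lozenge-unique aps ℓ∈ ℓ′∈ t∈ t∈′

    Tile-functional : ∀ {b u u′} → Tile b u → Tile b u′ → u ≡ u′
    Tile-functional (ℓ , ℓ∈ , refl , refl) (ℓ′ , ℓ′∈ , eq , refl) =
      cong up (lozenge-unique disjoint ℓ∈ ℓ′∈ (inj₁ refl) (inj₁ (cong ▽ (sym eq))))

    Tile-injective : ∀ {b b′ u} → Tile b u → Tile b′ u → b ≡ b′
    Tile-injective (ℓ , ℓ∈ , refl , refl) (ℓ′ , ℓ′∈ , refl , eq) =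
      cong down (lozenge-unique disjoint ℓ∈ ℓ′∈ (inj₂ refl) (inj₂ (cong △ (sym eq))))

    Tile-down : ∀ {b u} → Tile b u → suc (deg b) ≡ n × ¬ ⟨ I ⟩ b
    Tile-down (ℓ , ℓ∈ , refl , _) with All.lookup inside ℓ∈ (inj₁ refl)
    ... | degb , b∉ = suc-injective degb , b∉

    Tile-up : ∀ {b u} → Tile b u → deg u ≡ n × ¬ ⟨ I ⟩ u
    Tile-up (ℓ , ℓ∈ , _ , refl) with All.lookup inside ℓ∈ (inj₂ refl)
    ... | degu , u∉ = suc-injective degu , u∉

    tile-of-▽ : ∀ {b} → suc (deg b) ≡ n → ¬ ⟨ I ⟩ b → ∃ λ i → Tile b (X i · b)
    tile-of-▽ degb b∉ with find (covering {▽ _} (cong suc degb , b∉))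
    ... | ℓ , ℓ∈ , inj₁ refl with sharesEdge ℓ
    ...   | i , eq = i , ℓ , ℓ∈ , refl , eq

    tile-of-△ : ∀ {u} → deg u ≡ n → ¬ ⟨ I ⟩ u → ∃₂ λ b i → X i · b ≡ u × Tile b u
    tile-of-△ degu u∉ with find (covering {△ _} (cong suc degu , u∉))
    ... | ℓ , ℓ∈ , inj₂ refl with sharesEdge ℓ
    ...   | i , eq = down ℓ , i , sym eq , ℓ , ℓ∈ , refl , refl

    -- The partner of a downward-pointing triangle is labelled by a multiple of its label, so
    -- lozenges do not lead out of the triangle of `h` from there.
    outsideMultiples-≤ : ∀ h → length (filter (outsideMultiple? h) (monomials⁻ n)) ≤ length (filter (outsideMultiple? h) (monomials n))
    outsideMultiples-≤ h = length-≤-by-injection Tile Tile-injective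
      (Unique.filter⁺ (outsideMultiple? h) (monomials⁻-unique n)) partner
      where
      partner : ∀ {b} → b ∈ filter (outsideMultiple? h) (monomials⁻ n) →
        ∃ λ u → u ∈ filter (outsideMultiple? h) (monomials n) × Tile b u
      partner {b} b∈ with ∈-filter⁻ (outsideMultiple? h) {xs = monomials⁻ n} b∈
      ... | b∈L , h∣b , b∉ with tile-of-▽ (∈-monomials⁻⁻ n b∈L) b∉
      ...   | i , tile = X i · b , ∈-filter⁺ (outsideMultiple? h) (∈-monomials⁺ (proj₁ (Tile-up tile)))
                (∣-trans h∣b (∣-X i b) , proj₂ (Tile-up tile)) , tile

    △Outside≤▽Outside : length △Outside ≤ length ▽Outside
    △Outside≤▽Outside = length-≤-by-injection (λ u b → Tile b u) Tile-functional
      (Unique.filter⁺ (¬? ∘ member?) (monomials-unique n)) partner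
      where
      partner : ∀ {u} → u ∈ △Outside → ∃ λ b → b ∈ ▽Outside × Tile b u
      partner u∈ with ∈-filter⁻ (¬? ∘ member?) {xs = monomials n} u∈
      ... | u∈L , u∉ with tile-of-△ (∈-monomials⁻ n u∈L) u∉
      ...   | b , _ , _ , tile = b , ∈-filter⁺ (¬? ∘ member?) (∈-monomials⁻⁺ (proj₁ (Tile-down tile))) (proj₂ (Tile-down tile)) , tile

    ▽Outside≤△Outside : length ▽Outside ≤ length △Outside
    ▽Outside≤△Outside = length-≤-by-injection Tile Tile-injective
      (Unique.filter⁺ (¬? ∘ member?) (monomials⁻-unique n)) partner
      where
      partner : ∀ {b} → b ∈ ▽Outside → ∃ λ u → u ∈ △Outside × Tile b u
      partner {b} b∈ with ∈-filter⁻ (¬? ∘ member?) {xs = monomials⁻ n} b∈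
      ... | b∈L , b∉ with tile-of-▽ (∈-monomials⁻⁻ n b∈L) b∉
      ...   | i , tile = X i · b , ∈-filter⁺ (¬? ∘ member?) (∈-monomials⁺ (proj₁ (Tile-up tile))) (proj₂ (Tile-up tile)) , tile

    -- The tiling pairs off the triangles outside `I`, so the surplus n + 1 of the whole triangle
    -- lies inside.
    △Inside≡ : length △Inside ≡ length ▽Inside + suc n
    △Inside≡ = +-cancelʳ-≡ (length △Outside) _ _ (begin
      length △Inside + length △Outside               ≡⟨ inside-outside ⟩
      length ▽Inside + length ▽Outside + suc n       ≡⟨ cong (λ k → length ▽Inside + k + suc n) (≤-antisym ▽Outside≤△Outside △Outside≤▽Outside) ⟩
      length ▽Inside + length △Outside + suc n       ≡⟨ swap (length ▽Inside) (length △Outside) (suc n) ⟩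
      length ▽Inside + suc n + length △Outside       ∎)
      where
      open ≡-Reasoning
      swap : ∀ a b c → a + b + c ≡ a + c + b
      swap = solve-∀

    -- The identity S = d + o, with o the difference of the two sums of excesses.
    excess≡ : suc n + Σ (monomials n) excess ≡ sides + Σ (monomials⁻ n) excess
    excess≡ = +-cancelˡ-≡ (length ▽Inside) _ _ (begin
      length ▽Inside + (suc n + Σ (monomials n) excess)       ≡⟨ +-assoc (length ▽Inside) (suc n) _ ⟨
      length ▽Inside + suc n + Σ (monomials n) excess         ≡⟨ cong (_+ Σ (monomials n) excess) △Inside≡ ⟨
      length △Inside + Σ (monomials n) excess                 ≡⟨ inside-count ⟩
      length ▽Inside + Σ (monomials⁻ n) excess + sides        ≡⟨ swap (length ▽Inside) (Σ (monomials⁻ n) excess) sides ⟩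
      length ▽Inside + (sides + Σ (monomials⁻ n) excess)      ∎)
      where
      open ≡-Reasoning
      swap : ∀ a b c → a + b + c ≡ a + (c + b)
      swap = solve-∀

    module _ (sides≡ : sides ≡ suc n) where

      excess≡0 : ∀ {u} → deg u ≡ n → excess u ≡ 0
      excess≡0 = Σ-monomials⁻-≡ n excess-X (≤-reflexive (+-cancelˡ-≡ (suc n) _ _
        (trans excess≡ (cong (_+ Σ (monomials⁻ n) excess) sides≡))))

      excess⁻≡0 : ∀ {b} → suc (deg b) ≡ n → excess b ≡ 0
      excess⁻≡0 {b} degb = n≤0⇒n≡0 (≤-trans (excess-X 0F b) (≤-reflexive (excess≡0 (trans (deg-X 0F b) degb))))

      -- Without overlaps, a multiple of `h` lies outside `I` or in exactly one puncture.
      multiples-split : ∀ L h → (∀ {u} → u ∈ L → excess u ≡ 0) → Σ L (λ u → 𝟙 (h ∣? u)) ≡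
        length (filter (outsideMultiple? h) L) + Σ indices (λ i → Σ L (λ u → 𝟙 (h ∣? u ×-dec gen I i ∣? u)))
      multiples-split L h none = begin
        Σ L (λ u → 𝟙 (h ∣? u))
          ≡⟨ Σ-cong L (λ {u} u∈ → sym (pointwise u (none u∈))) ⟩
        Σ L (λ u → 𝟙 (outsideMultiple? h u) + Σ indices (λ i → 𝟙 (h ∣? u ×-dec gen I i ∣? u)))
          ≡⟨ Σ-distrib-+ L _ _ ⟩
        Σ L (λ u → 𝟙 (outsideMultiple? h u)) + Σ L (λ u → Σ indices (λ i → 𝟙 (h ∣? u ×-dec gen I i ∣? u)))
          ≡⟨ cong₂ _+_ (sym (length-filter-Σ (outsideMultiple? h) L)) (Σ-comm L indices _) ⟩
        length (filter (outsideMultiple? h) L) + Σ indices (λ i → Σ L (λ u → 𝟙 (h ∣? u ×-dec gen I i ∣? u))) ∎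
        where
        open ≡-Reasoning
        pointwise : ∀ u → excess u ≡ 0 →
          𝟙 (outsideMultiple? h u) + Σ indices (λ i → 𝟙 (h ∣? u ×-dec gen I i ∣? u)) ≡ 𝟙 (h ∣? u)
        pointwise u ex with h ∣? u
        ... | no _  = trans (Σ-const indices 0) (*-zeroʳ (length indices))
        ... | yes _ = trans (cong (_+_ (𝟙 (¬? (member? u)))) (trans (multiplicity≡ u) (trans (cong (_+_ (𝟙 (member? u))) ex) (+-identityʳ _))))
                        (complement (member? u))
          where
          complement : ∀ {P : Set} (p : Dec P) → 𝟙 (¬? p) + 𝟙 p ≡ 1
          complement (yes _) = refl
          complement (no _)  = refl

      -- The surplus `size n h` of the triangle of `h` splits into that of its part outside `I` and
      -- those of its intersections with the punctures. None is negative, and a puncture from `J`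
      -- lies inside entirely and contributes its side.
      sides-≤ : ∀ J h → (∀ i → i ∈ˢ J → h ∣ gen I i) → ΣOver J side ≤ size n h
      sides-≤ J h h∣ = +-cancelˡ-≤ (Σ indices a⁻) _ _ (begin
        Σ indices a⁻ + ΣOver J side
          ≡⟨ Σ-distrib-+ indices a⁻ _ ⟨
        Σ indices (λ i → a⁻ i + (if lookup J i then side i else 0))
          ≤⟨ Σ-mono indices (λ {i} _ → puncture i (lookup J i) refl) ⟩
        Σ indices a
          ≤⟨ +-cancelˡ-≤ out⁻ _ _ total ⟩
        Σ indices a⁻ + size n h ∎)
        where
        open ≤-Reasoning
        a a⁻ : Fin (m I) → ℕ
        a  i = Σ (monomials n) (λ u → 𝟙 (h ∣? u ×-dec gen I i ∣? u))
        a⁻ i = Σ (monomials⁻ n) (λ u → 𝟙 (h ∣? u ×-dec gen I i ∣? u))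
        out⁻ = length (filter (outsideMultiple? h) (monomials⁻ n))
        total : out⁻ + Σ indices a ≤ out⁻ + (Σ indices a⁻ + size n h)
        total = begin
          out⁻ + Σ indices a
            ≤⟨ +-monoˡ-≤ (Σ indices a) (outsideMultiples-≤ h) ⟩
          length (filter (outsideMultiple? h) (monomials n)) + Σ indices a
            ≡⟨ multiples-split (monomials n) h (λ u∈ → excess≡0 (∈-monomials⁻ n u∈)) ⟨
          Σ (monomials n) (λ u → 𝟙 (h ∣? u))
            ≡⟨ countMultiples n h ⟩
          Σ (monomials⁻ n) (λ u → 𝟙 (h ∣? u)) + size n h
            ≡⟨ cong (_+ size n h) (multiples-split (monomials⁻ n) h (λ b∈ → excess⁻≡0 (∈-monomials⁻⁻ n b∈))) ⟩
          out⁻ + Σ indices a⁻ + size n h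
            ≡⟨ +-assoc out⁻ (Σ indices a⁻) (size n h) ⟩
          out⁻ + (Σ indices a⁻ + size n h) ∎
        puncture : ∀ i b → lookup J i ≡ b → a⁻ i + (if b then side i else 0) ≤ a i
        puncture i false eq = ≤-trans (≤-reflexive (+-identityʳ _)) (Σ-monomials⁻-≤ n (λ b →
          𝟙-mono (h ∣? b ×-dec gen I i ∣? b) (h ∣? X 0F · b ×-dec gen I i ∣? X 0F · b)
            (λ { (p , q) → ∣-trans p (∣-X 0F b) , ∣-trans q (∣-X 0F b) })))
        puncture i true eq = ≤-reflexive (begin-equality
          a⁻ i + side i                                            ≡⟨ cong (_+ side i) (drop-h (monomials⁻ n)) ⟩
          Σ (monomials⁻ n) (λ u → 𝟙 (gen I i ∣? u)) + side i       ≡⟨ countMultiples n (gen I i) ⟨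
          Σ (monomials n) (λ u → 𝟙 (gen I i ∣? u))                 ≡⟨ drop-h (monomials n) ⟨
          a i                                                      ∎)
          where
          drop-h : ∀ L → Σ L (λ u → 𝟙 (h ∣? u ×-dec gen I i ∣? u)) ≡ Σ L (λ u → 𝟙 (gen I i ∣? u))
          drop-h L = Σ-cong L (λ {u} _ → 𝟙-cong (h ∣? u ×-dec gen I i ∣? u) (gen I i ∣? u) proj₂
            (λ g∣u → ∣-trans (h∣ i (Vec.lookup⇒[]= i J eq)) g∣u , g∣u))

      semistable : SyzygyBundleSemistable I
      semistable J J⊂⊤ 2≤ h isGCD = slopeInequality⁺ J 2≤ h h≤ (+-mono-≤
        (*-monoˡ-≤ (m I ∸ 1) (sides-≤ J h (λ i → IsGCD.commonDivisor isGCD)))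
        (*-monoˡ-≤ (∣ J ∣ ∸ 1) (≤-reflexive (sym sides≡))))
        where
        h≤ : deg h ≤ suc n
        h≤ with ∣∣>0⇒∃∈ J (≤-trans (n≤1+n 1) 2≤)
        ... | i , i∈ = ≤-trans (deg-mono (IsGCD.commonDivisor isGCD i∈)) (bound i)

-- Tilings from semistability

module SemistableTilings (I : MonomialIdeal) (n : ℕ) (bound : ∀ i → deg (gen I i) ≤ suc n)
  (ss : SyzygyBundleSemistable I) (2≤m : 2 ≤ m I) (coprime : ∀ {h} → (∀ i → h ∣ gen I i) → deg h ≡ 0) where

  open Punctured I n bound

  module Balanced (sides≡ : sides ≡ suc n) where

    open Semistable ss 2≤m coprime 0 (trans sides≡ (sym (+-identityʳ (suc n))))

    -- The swept family contains every puncture of positive side. With o = 0, semistability forces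
    -- its total side to be at least n + 1, and the sweep bounds that side from above.
    side-length-≤ : ∀ W → AllPairs Above W → All (λ w → deg w ≡ n) W →
      (∀ {i u} → gen I i ∣ u → deg u ≡ n → u ∈ W) → ∀ {Bs} → Unique Bs → (∀ {b} → b ∈ Bs → ∀ i → X i · b ∈ W) →
      suc n + length Bs ≤ length W
    side-length-≤ W W↑ W≡n inside⊆ {Bs} B! N⊆ with sweep n W W↑ W≡n B! N⊆
    ... | H , fam , covers , le = ≤-trans (+-monoˡ-≤ (length Bs) (*-cancelʳ-≤ (suc n) (Σ H (size n)) M (begin
      suc n * M                          ≤⟨ weights-≥ ⟩
      Σ indices weight + 0               ≡⟨ +-identityʳ _ ⟩
      Σ indices weight                   ≤⟨ weights-≤ H (generators-covered fam covers inside⊆) ⟩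
      Σ H (λ h → size n h * M)           ≡⟨ Σ-distribʳ-* H (size n) M ⟩
      Σ H (size n) * M                   ∎))) le
      where
      open ≤-Reasoning
      instance
        M-nonZero : NonZero M
        M-nonZero = >-nonZero (m<n⇒0<n∸m 2≤m)

    △Inside≡ : length △Inside ≡ length ▽Inside + suc n
    △Inside≡ = ≤-antisym
      (≤-trans △Inside≤ (≤-reflexive (cong (_+_ (length ▽Inside)) sides≡)))
      (≤-trans (≤-reflexive (+-comm (length ▽Inside) (suc n)))
        (side-length-≤ △Inside (AllPairs.filter⁺ member? (monomials-sorted n))
          (All.tabulate (λ w∈ → ∈-monomials⁻ n (proj₁ (∈-filter⁻ member? w∈))))
          (λ g∣u degu → ∈-filter⁺ member? (∈-monomials⁺ degu) (_ , g∣u))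
          (Unique.filter⁺ member? (monomials⁻-unique n)) X-∈-inside))

    △Outside≤▽Outside : length △Outside ≤ length ▽Outside
    △Outside≤▽Outside = +-cancelˡ-≤ (length ▽Inside + suc n) _ _ (≤-reflexive (begin
      length ▽Inside + suc n + length △Outside   ≡⟨ cong (_+ length △Outside) △Inside≡ ⟨
      length △Inside + length △Outside           ≡⟨ inside-outside ⟩
      length ▽Inside + length ▽Outside + suc n   ≡⟨ swap (length ▽Inside) (length ▽Outside) (suc n) ⟩
      length ▽Inside + suc n + length ▽Outside   ∎))
      where
      open ≡-Reasoning
      swap : ∀ a b c → a + b + c ≡ a + c + b
      swap = solve-∀

    open Hall {Monomial} _≟_

    neighbours : Monomial → List Monomial
    neighbours b = filter (¬? ∘ member?) (map (X_· b) (allFin 3))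

    ∈-neighbours⁻ : ∀ {b u} → u ∈ neighbours b → (∃ λ i → u ≡ X i · b) × ¬ ⟨ I ⟩ u
    ∈-neighbours⁻ {b} u∈ with ∈-filter⁻ (¬? ∘ member?) {xs = map (X_· b) (allFin 3)} u∈
    ... | u∈map , u∉ with ∈-map⁻ (X_· b) u∈map
    ...   | i , _ , eq = (i , eq) , u∉

    -- `as` and the downward-pointing triangles inside `I` have all their neighbours in the union of
    -- the punctures and `rs`. After `side-length-≤` the inside parts cancel by `△Inside≡`.
    hallCondition : HallCondition neighbours ▽Outside
    hallCondition {as} {rs} as! as⊆ nbrs = +-cancelˡ-≤ (length ▽Inside + suc n) _ _ (begin
      length ▽Inside + suc n + length as        ≡⟨ swap (length ▽Inside) (suc n) (length as) ⟩
      suc n + (length as + length ▽Inside)      ≡⟨ cong (_+_ (suc n)) (length-++ as) ⟨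
      suc n + length (as ++ ▽Inside)            ≤⟨ side-length-≤ W (AllPairs.filter⁺ W? (monomials-sorted n))
                                                     (All.tabulate (λ w∈ → ∈-monomials⁻ n (proj₁ (∈-filter⁻ W? w∈))))
                                                     (λ g∣u degu → ∈-filter⁺ W? (∈-monomials⁺ degu) (inj₁ (_ , g∣u)))
                                                     (Unique.++⁺ as! (Unique.filter⁺ member? (monomials⁻-unique n)) disj) N⊆W ⟩
      length W                                  ≤⟨ length-≤-⊆ (Unique.filter⁺ W? (monomials-unique n)) W⊆ ⟩
      length (△Inside ++ rs)                    ≡⟨ length-++ △Inside ⟩
      length △Inside + length rs                ≡⟨ cong (_+ length rs) △Inside≡ ⟩
      length ▽Inside + suc n + length rs        ∎)
      where
      open ≤-Reasoning
      swap : ∀ a b c → a + b + c ≡ b + (c + a)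
      swap = solve-∀
      W? : Decidable (λ u → ⟨ I ⟩ u ⊎ u ∈ rs)
      W? u = member? u ⊎-dec Any.any? (u ≟_) rs
      W : List Monomial
      W = filter W? (monomials n)
      disj : ∀ {b} → ¬ (b ∈ as × b ∈ ▽Inside)
      disj (b∈as , b∈In) = proj₂ (∈-filter⁻ (¬? ∘ member?) {xs = monomials⁻ n} (as⊆ b∈as)) (proj₂ (∈-filter⁻ member? {xs = monomials⁻ n} b∈In))
      W⊆ : ∀ {u} → u ∈ W → u ∈ △Inside ++ rs
      W⊆ u∈ with ∈-filter⁻ W? {xs = monomials n} u∈
      ... | u∈L , inj₁ u∈I  = ∈-++⁺ˡ (∈-filter⁺ member? u∈L u∈I)
      ... | _   , inj₂ u∈rs = ∈-++⁺ʳ △Inside u∈rs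
      N⊆W : ∀ {b} → b ∈ as ++ ▽Inside → ∀ i → X i · b ∈ W
      N⊆W {b} b∈ i with ∈-++⁻ as b∈
      ... | inj₂ b∈In with ∈-filter⁻ member? {xs = monomials n} (X-∈-inside b∈In i)
      ...   | Xb∈L , Xb∈I = ∈-filter⁺ W? Xb∈L (inj₁ Xb∈I)
      N⊆W {b} b∈ i | inj₁ b∈as = ∈-filter⁺ W? (∈-monomials⁺ (trans (deg-X i b) (∈-monomials⁻⁻ n (proj₁
        (∈-filter⁻ (¬? ∘ member?) {xs = monomials⁻ n} (as⊆ b∈as)))))) in-or-nbr
        where
        in-or-nbr : ⟨ I ⟩ (X i · b) ⊎ X i · b ∈ rs
        in-or-nbr with member? (X i · b)
        ... | yes ∈I = inj₁ ∈I
        ... | no ∉I  = inj₂ (nbrs b∈as (∈-filter⁺ (¬? ∘ member?) (∈-map⁺ (X_· b) (∈-allFin i)) ∉I))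

    toLozenge : ∀ {p} → proj₂ p ∈ neighbours (proj₁ p) → Lozenge
    toLozenge {b , u} u∈ = lozenge b u (proj₁ (∈-neighbours⁻ u∈))

    toLozenges : ∀ {M} → All (λ p → proj₂ p ∈ neighbours (proj₁ p)) M → List Lozenge
    toLozenges = All.reduce toLozenge

    map-down : ∀ {M} (edges : All (λ p → proj₂ p ∈ neighbours (proj₁ p)) M) → map Lozenge.down (toLozenges edges) ≡ map proj₁ M
    map-down []          = refl
    map-down (_ ∷ edges) = cong (_ ∷_) (map-down edges)

    map-up : ∀ {M} (edges : All (λ p → proj₂ p ∈ neighbours (proj₁ p)) M) → map Lozenge.up (toLozenges edges) ≡ map proj₂ M
    map-up []          = refl
    map-up (_ ∷ edges) = cong (_ ∷_) (map-up edges)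

    tileable : Tileable (T (suc n) I)
    tileable with hall neighbours ▽Outside (Unique.filter⁺ (¬? ∘ member?) (monomials⁻-unique n)) hallCondition
    ... | Ms , (edges , rights!) , lefts↭ = inj₂ (ℓs , record { inside = All.tabulate inside ; covering = covering ; disjoint = disjoint })
      where
      open Lozenge
      ℓs : List Lozenge
      ℓs = toLozenges edges
      downs↭ : map down ℓs ↭ ▽Outside
      downs↭ = subst (_↭ ▽Outside) (sym (map-down edges)) lefts↭
      ups! : Unique (map up ℓs)
      ups! = subst Unique (sym (map-up edges)) rights!
      down∈ : ∀ {ℓ} → ℓ ∈ ℓs → suc (deg (down ℓ)) ≡ n × ¬ ⟨ I ⟩ (down ℓ)
      down∈ ℓ∈ with ∈-filter⁻ (¬? ∘ member?) {xs = monomials⁻ n} (∈-resp-↭ downs↭ (∈-map⁺ down ℓ∈))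
      ... | b∈L , b∉ = ∈-monomials⁻⁻ n b∈L , b∉
      up-deg : ∀ {ℓ} → ℓ ∈ ℓs → deg (up ℓ) ≡ n
      up-deg {ℓ} ℓ∈ with sharesEdge ℓ
      ... | i , eq = trans (cong deg eq) (trans (deg-X i (down ℓ)) (proj₁ (down∈ ℓ∈)))
      up∉ : ∀ {ℓ} → ℓ ∈ ℓs → ¬ ⟨ I ⟩ (up ℓ)
      up∉ ℓ∈ with ∈-map⁻ proj₂ (subst (_ ∈_) (map-up edges) (∈-map⁺ up ℓ∈))
      ... | p , p∈ , eq = subst (λ u → ¬ ⟨ I ⟩ u) (sym eq) (proj₂ (∈-neighbours⁻ (All.lookup edges p∈)))
      inside : ∀ {ℓ} → ℓ ∈ ℓs → ∀ {t} → ⟦ ℓ ⟧ t → T (suc n) I t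
      inside ℓ∈ (inj₁ refl) = cong suc (proj₁ (down∈ ℓ∈)) , proj₂ (down∈ ℓ∈)
      inside ℓ∈ (inj₂ refl) = cong suc (up-deg ℓ∈) , up∉ ℓ∈
      ups⊆ : ∀ {u} → u ∈ map up ℓs → u ∈ △Outside
      ups⊆ u∈ with ∈-map⁻ up u∈
      ... | ℓ , ℓ∈ , refl = ∈-filter⁺ (¬? ∘ member?) (∈-monomials⁺ (up-deg ℓ∈)) (up∉ ℓ∈)
      ups⊇ : ∀ {u} → u ∈ △Outside → u ∈ map up ℓs
      -- There are as many lozenges as entries of `▽Outside`, and their upward-pointing triangles
      -- are distinct, so they exhaust `△Outside`.
      ups⊇ = Unique-⊆-reverse _≟_ ups! ups⊆ (≤-trans △Outside≤▽Outside (≤-reflexive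
        (trans (sym (↭-length downs↭)) (trans (length-map down ℓs) (sym (length-map up ℓs))))))
      covering : ∀ {t} → T (suc n) I t → Any (λ ℓ → ⟦ ℓ ⟧ t) ℓs
      covering {▽ b} (degb , b∉) with ∈-map⁻ down (∈-resp-↭ (↭-sym downs↭)
        (∈-filter⁺ (¬? ∘ member?) (∈-monomials⁻⁺ (suc-injective degb)) b∉))
      ... | ℓ , ℓ∈ , refl = lose ℓ∈ (inj₁ refl)
      covering {△ u} (degu , u∉) with ∈-map⁻ up (ups⊇ (∈-filter⁺ (¬? ∘ member?) (∈-monomials⁺ (suc-injective degu)) u∉))
      ... | ℓ , ℓ∈ , refl = lose ℓ∈ (inj₂ refl)
      disjoint : AllPairs (λ ℓ ℓ′ → ∀ {t} → ¬ (⟦ ℓ ⟧ t × ⟦ ℓ′ ⟧ t)) ℓs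
      disjoint = AllPairs.map
        (λ { (d≢ , u≢) (inj₁ refl , inj₁ refl) → d≢ refl ; (d≢ , u≢) (inj₂ refl , inj₂ refl) → u≢ refl })
        (AllPairs.zip (AllPairs.map⁻ {f = down} (Unique-resp-↭ (↭-sym downs↭)
          (Unique.filter⁺ (¬? ∘ member?) (monomials⁻-unique n))) , AllPairs.map⁻ {f = up} ups!))

-- Cuts along a tiling

-- The three variables in an arbitrary order, so that one construction of paths serves all
-- directions; `reverse` gives the second path of a cut.
record Coordinates (a j c : Fin 3) : Set where
  field
    a≢j   : a ≢ j
    a≢c   : a ≢ c
    j≢c   : j ≢ c
    every : ∀ i → i ≡ a ⊎ i ≡ j ⊎ i ≡ c
    deg≡  : ∀ v → deg v ≡ lookup v a + lookup v j + lookup v c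

reverse : ∀ {a j c} → Coordinates a j c → Coordinates c j a
reverse {a} {j} {c} coords = record
  { a≢j = ≢-sym j≢c ; a≢c = ≢-sym a≢c ; j≢c = ≢-sym a≢j
  ; every = λ i → [ inj₂ ∘ inj₂ , [ inj₂ ∘ inj₁ , inj₁ ]′ ]′ (every i)
  ; deg≡ = λ v → trans (deg≡ v) (swap (lookup v a) (lookup v j) (lookup v c)) }
  where
  open Coordinates coords
  swap : ∀ p q r → p + q + r ≡ r + q + p
  swap = solve-∀

coordinates : ∀ j → ∃₂ λ a c → Coordinates a j c
coordinates 0F = 1F , 2F , record
  { a≢j = λ () ; a≢c = λ () ; j≢c = λ ()
  ; every = λ { 0F → inj₂ (inj₁ refl) ; 1F → inj₁ refl ; 2F → inj₂ (inj₂ refl) }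
  ; deg≡ = λ { (x ∷ y ∷ z ∷ []) → swap x y z } }
  where
  swap : ∀ x y z → x + (y + (z + 0)) ≡ y + x + z
  swap = solve-∀
coordinates 1F = 0F , 2F , record
  { a≢j = λ () ; a≢c = λ () ; j≢c = λ ()
  ; every = λ { 0F → inj₁ refl ; 1F → inj₂ (inj₁ refl) ; 2F → inj₂ (inj₂ refl) }
  ; deg≡ = λ { (x ∷ y ∷ z ∷ []) → swap x y z } }
  where
  swap : ∀ x y z → x + (y + (z + 0)) ≡ x + y + z
  swap = solve-∀
coordinates 2F = 0F , 1F , record
  { a≢j = λ () ; a≢c = λ () ; j≢c = λ ()
  ; every = λ { 0F → inj₁ refl ; 1F → inj₂ (inj₂ refl) ; 2F → inj₂ (inj₁ refl) }
  ; deg≡ = λ { (x ∷ y ∷ z ∷ []) → swap x y z } }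
  where
  swap : ∀ x y z → x + (y + (z + 0)) ≡ x + z + y
  swap = solve-∀

X-same : ∀ i (b : Monomial) → lookup (X i · b) i ≡ suc (lookup b i)
X-same i b = Vec.lookup∘updateAt i b

X-other : ∀ {i k} (b : Monomial) → k ≢ i → lookup (X i · b) k ≡ lookup b k
X-other {i} {k} b k≢i = Vec.lookup∘updateAt′ k i k≢i b

X-lookup-≤ : ∀ i k (b : Monomial) → lookup (X i · b) k ≤ suc (lookup b k)
X-lookup-≤ i k b with k Fin.≟ i
... | yes refl = ≤-reflexive (X-same i b)
... | no k≢i   = ≤-trans (≤-reflexive (X-other b k≢i)) (n≤1+n _)

X-predecessor : ∀ a (u : Monomial) {k} → lookup u a ≡ suc k → ∃ λ b → X a · b ≡ u
X-predecessor 0F (suc x ∷ y ∷ z ∷ []) eq = x ∷ y ∷ z ∷ [] , refl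
X-predecessor 1F (x ∷ suc y ∷ z ∷ []) eq = x ∷ y ∷ z ∷ [] , refl
X-predecessor 2F (x ∷ y ∷ suc z ∷ []) eq = x ∷ y ∷ z ∷ [] , refl

lookup-ext : ∀ {u v : Monomial} → (∀ i → lookup u i ≡ lookup v i) → u ≡ v
lookup-ext {u} {v} eq = trans (sym (Vec.tabulate∘lookup u)) (trans (Vec.tabulate-cong eq) (Vec.tabulate∘lookup v))

module Separation (I : MonomialIdeal) (n : ℕ) (bound : ∀ i → deg (gen I i) ≤ suc n)
  (ℓs : List Lozenge) (partition : IsPartition (T (suc n) I) ℓs) where

  open Punctured I n bound
  open Tilings I n bound
  open Tiling ℓs partition

  module Direction {a j c : Fin 3} (coords : Coordinates a j c) where

    open Coordinates coords

    same-monomial : ∀ {u v : Monomial} → deg u ≡ deg v → lookup u a ≡ lookup v a → lookup u j ≡ lookup v j → u ≡ v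
    same-monomial {u} {v} degs eqa eqj = lookup-ext λ i → [ (λ { refl → eqa }) , [ (λ { refl → eqj }) , (λ { refl → eqc }) ]′ ]′ (every i)
      where
      eqc : lookup u c ≡ lookup v c
      eqc = +-cancelˡ-≡ (lookup v a + lookup v j) _ _ (trans (cong₂ (λ p q → p + q + lookup u c) (sym eqa) (sym eqj))
        (trans (sym (deg≡ u)) (trans degs (deg≡ v))))

    -- The lozenge of `u` avoids the edge opposite to the a-direction, so a path can leave across
    -- that edge.
    Node : Monomial → Set
    Node u = ∃₂ λ b i → i ≢ a × X i · b ≡ u × Tile b u

    -- The path crosses into `b′`, which is `u` divided by the variable `a`, and follows the lozenge
    -- of `b′` to `u′`. That lozenge is not the one of `u`, so `u′` lies in a direction other than
    -- `a` and is a node again.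
    step : ∀ {u k} → Node u → lookup u a ≡ suc k → ∃ λ u′ → Node u′ × lookup u′ a ≡ k ×
      (lookup u j ≤ lookup u′ j × lookup u′ j ≤ suc (lookup u j)) × lookup u c ≤ lookup u′ c
    step {u} {k} (b , i , i≢a , Xb≡u , tile) ua with X-predecessor a u ua
    ... | b′ , Xb′≡u with tile-of-▽ {b′} (trans (sym (deg-X a b′)) (trans (cong deg Xb′≡u) (proj₁ (Tile-up tile))))
                          (λ b′∈ → proj₂ (Tile-up tile) (member-∣ b′∈ (subst (b′ ∣_) Xb′≡u (∣-X a b′))))
    ...   | i′ , tile′ = X i′ · b′ , (b′ , i′ , i′≢a , refl , tile′) , u′a , u′j , u′c
      where
      i′≢a : i′ ≢ a
      i′≢a refl = 1+n≢n (begin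
        suc (lookup b a)      ≡⟨ X-same a b ⟨
        lookup (X a · b) a    ≡⟨ cong (λ b → lookup (X a · b) a) (Tile-injective tile (subst (Tile b′) Xb′≡u tile′)) ⟩
        lookup (X a · b′) a   ≡⟨ cong (λ u → lookup u a) (trans Xb′≡u (sym Xb≡u)) ⟩
        lookup (X i · b) a    ≡⟨ X-other b (≢-sym i≢a) ⟩
        lookup b a            ∎)
        where open ≡-Reasoning
      lookup-b′ : ∀ {e} → e ≢ a → lookup b′ e ≡ lookup u e
      lookup-b′ e≢a = trans (sym (X-other b′ e≢a)) (cong (λ u → lookup u _) Xb′≡u)
      u′a : lookup (X i′ · b′) a ≡ k
      u′a = trans (X-other b′ (≢-sym i′≢a)) (suc-injective (trans (sym (X-same a b′)) (trans (cong (λ u → lookup u a) Xb′≡u) ua)))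
      grow : ∀ {e} → e ≢ a → lookup u e ≤ lookup (X i′ · b′) e
      grow {e} e≢a with e Fin.≟ i′
      ... | yes refl = ≤-trans (≤-reflexive (sym (lookup-b′ e≢a))) (≤-trans (n≤1+n _) (≤-reflexive (sym (X-same i′ b′))))
      ... | no e≢i′  = ≤-reflexive (trans (sym (lookup-b′ e≢a)) (sym (X-other b′ e≢i′)))
      u′j : lookup u j ≤ lookup (X i′ · b′) j × lookup (X i′ · b′) j ≤ suc (lookup u j)
      u′j = grow (≢-sym a≢j) , ≤-trans (X-lookup-≤ i′ j b′) (s≤s (≤-reflexive (lookup-b′ (≢-sym a≢j))))
      u′c : lookup u c ≤ lookup (X i′ · b′) c
      u′c = grow (≢-sym a≢c)

    -- A path through the tiling from the triangle labelled u₀ to the edge where the a-exponent vanishes.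
    record Chain (u₀ : Monomial) : Set where
      field
        nodes   : List Monomial
        start   : u₀ ∈ nodes
        outside : ∀ {w} → w ∈ nodes → deg w ≡ n × ¬ ⟨ I ⟩ w
        bounds  : ∀ {w} → w ∈ nodes → lookup w a ≤ lookup u₀ a × lookup u₀ j ≤ lookup w j × lookup u₀ c ≤ lookup w c
        level   : ∀ {e} → e ≤ lookup u₀ a → ∃ λ w → w ∈ nodes × lookup w a ≡ e
        up      : ∀ {w} → w ∈ nodes → lookup w a < lookup u₀ a →
                  ∃ λ v → v ∈ nodes × lookup v a ≡ suc (lookup w a) × lookup v j ≤ lookup w j
        down    : ∀ {w e} → w ∈ nodes → lookup w a ≡ suc e →
                  ∃ λ v → v ∈ nodes × lookup v a ≡ e × lookup v j ≤ suc (lookup w j)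

    chain : ∀ k {u} → lookup u a ≡ k → Node u → Chain u
    chain zero {u} ua node = record
      { nodes   = u ∷ []
      ; start   = here refl
      ; outside = λ { (here refl) → Tile-up (proj₂ (proj₂ (proj₂ (proj₂ node)))) }
      ; bounds  = λ { (here refl) → ≤-refl , ≤-refl , ≤-refl }
      ; level   = λ e≤ → u , here refl , trans ua (sym (n≤0⇒n≡0 (≤-trans e≤ (≤-reflexive ua))))
      ; up      = λ { (here refl) lt → contradiction lt (<-irrefl refl) }
      ; down    = λ { (here refl) eq → contradiction (trans (sym ua) eq) 0≢1+n }
      }
    chain (suc k) {u} ua node with step node ua
    ... | u′ , node′ , u′a , (uj≤ , u′j≤) , uc≤ = record
      { nodes   = u ∷ nodes
      ; start   = here refl
      ; outside = λ { (here refl) → Tile-up (proj₂ (proj₂ (proj₂ (proj₂ node)))) ; (there w∈) → outside w∈ }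
      ; bounds  = λ { (here refl) → ≤-refl , ≤-refl , ≤-refl ; (there w∈) → bounds′ w∈ }
      ; level   = level′
      ; up      = λ { (here refl) lt → contradiction lt (<-irrefl refl) ; (there w∈) lt → up′ w∈ lt }
      ; down    = λ { (here refl) eq → u′-down eq ; (there w∈) eq → weaken (down w∈ eq) }
      }
      where
      open Chain (chain k u′a node′)
      u′a<ua : lookup u a ≡ suc (lookup u′ a)
      u′a<ua = trans ua (cong suc (sym u′a))
      weaken : ∀ {P : Monomial → Set} → (∃ λ v → v ∈ nodes × P v) → ∃ λ v → v ∈ u ∷ nodes × P v
      weaken (v , v∈ , p) = v , there v∈ , p
      bounds′ : ∀ {w} → w ∈ nodes → lookup w a ≤ lookup u a × lookup u j ≤ lookup w j × lookup u c ≤ lookup w c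
      bounds′ w∈ with bounds w∈
      ... | wa , wj , wc = ≤-trans wa (≤-trans (n≤1+n _) (≤-reflexive (sym u′a<ua))) , ≤-trans uj≤ wj , ≤-trans uc≤ wc
      level′ : ∀ {e} → e ≤ lookup u a → ∃ λ w → w ∈ u ∷ nodes × lookup w a ≡ e
      level′ {e} e≤ with e ≤? lookup u′ a
      ... | yes e≤′ = weaken (level e≤′)
      ... | no e≰   = u , here refl , ≤-antisym (≤-trans (≤-reflexive u′a<ua) (≰⇒> e≰)) e≤
      up′ : ∀ {w} → w ∈ nodes → lookup w a < lookup u a →
        ∃ λ v → v ∈ u ∷ nodes × lookup v a ≡ suc (lookup w a) × lookup v j ≤ lookup w j
      up′ {w} w∈ lt with lookup w a <? lookup u′ a
      ... | yes lt′ = weaken (up w∈ lt′)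
      ... | no ≮    = u , here refl , trans u′a<ua (cong suc (≤-antisym (≮⇒≥ ≮) (proj₁ (bounds w∈)))) ,
                        proj₁ (proj₂ (bounds′ w∈))
      u′-down : ∀ {e} → lookup u a ≡ suc e → ∃ λ v → v ∈ u ∷ nodes × lookup v a ≡ e × lookup v j ≤ suc (lookup u j)
      u′-down eq = u′ , there start , trans u′a (suc-injective (trans (sym ua) eq)) , u′j≤

    module Beside {u₀ : Monomial} (path : Chain u₀) where

      open Chain path

      -- The side of the path towards the corner of the variable `j`, decided within the level of
      -- constant a-exponent.
      Beside : Monomial → Set
      Beside v = Any (λ w → lookup w a ≡ lookup v a × lookup w j < lookup v j) nodes

      beside? : Decidable Beside
      beside? v = Any.any? (λ w → (lookup w a ℕ.≟ lookup v a) ×-dec (lookup w j <? lookup v j)) nodes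

      beside-bounds : ∀ v → Beside v → lookup v a ≤ lookup u₀ a × lookup u₀ j < lookup v j
      beside-bounds v p with find p
      ... | w , w∈ , wa , wj with bounds w∈
      ...   | wa≤ , u₀j≤ , _ = ≤-trans (≤-reflexive (sym wa)) wa≤ , ≤-trans (s≤s u₀j≤) wj

      -- The node `w` on the level of `v` has at least its c-exponent, hence at most its j-exponent.
      -- Equality would give w = v, but nodes lie outside `I`.
      beside-corner : ∀ {v} → deg v ≡ n → ⟨ I ⟩ v → lookup v a ≤ lookup u₀ a → lookup v c ≤ lookup u₀ c → Beside v
      beside-corner {v} degv v∈I va≤ vc≤ with level va≤
      ... | w , w∈ , wa with lookup w j <? lookup v j
      ...   | yes lt = lose w∈ (wa , lt)
      ...   | no ≮   = contradiction v∈I (subst (λ v → ¬ ⟨ I ⟩ v) w≡v (proj₂ (outside w∈)))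
        where
        vc≤wc : lookup v c ≤ lookup w c
        vc≤wc = ≤-trans vc≤ (proj₂ (proj₂ (bounds w∈)))
        wj≤ : lookup w j ≤ lookup v j
        wj≤ = +-cancelˡ-≤ (lookup v a) _ _ (+-cancelʳ-≤ (lookup v c) _ _ (begin
          lookup v a + lookup w j + lookup v c   ≤⟨ +-monoʳ-≤ (lookup v a + lookup w j) vc≤wc ⟩
          lookup v a + lookup w j + lookup w c   ≡⟨ cong (λ p → p + lookup w j + lookup w c) wa ⟨
          lookup w a + lookup w j + lookup w c   ≡⟨ deg≡ w ⟨
          deg w                                  ≡⟨ trans (proj₁ (outside w∈)) (sym degv) ⟩
          deg v                                  ≡⟨ deg≡ v ⟩
          lookup v a + lookup v j + lookup v c   ∎))
          where open ≤-Reasoning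
        w≡v : w ≡ v
        w≡v = same-monomial (trans (proj₁ (outside w∈)) (sym degv)) wa (≤-antisym wj≤ (≮⇒≥ ≮))

      module _ {b : Monomial} (degb : suc (deg b) ≡ n) (b∈I : ⟨ I ⟩ b) (ba< : lookup b a < lookup u₀ a) where

        private
          Xa-a = X-same a b
          Xc-a : lookup (X c · b) a ≡ lookup b a
          Xc-a = X-other b a≢c
          Xj-a : lookup (X j · b) a ≡ lookup b a
          Xj-a = X-other b a≢j
          Xa-j : lookup (X a · b) j ≡ lookup b j
          Xa-j = X-other b (≢-sym a≢j)
          Xc-j : lookup (X c · b) j ≡ lookup b j
          Xc-j = X-other b j≢c

          a⇒j : Beside (X a · b) → Beside (X j · b)
          a⇒j p with find p
          ... | w , w∈ , wa , wj with down w∈ (trans wa Xa-a)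
          ...   | v , v∈ , va , vj = lose v∈ (trans va (sym Xj-a) , (begin-strict
            lookup v j               ≤⟨ vj ⟩
            suc (lookup w j)         ≤⟨ wj ⟩
            lookup (X a · b) j       ≡⟨ Xa-j ⟩
            lookup b j               <⟨ n<1+n _ ⟩
            suc (lookup b j)         ≡⟨ X-same j b ⟨
            lookup (X j · b) j       ∎))
            where open ≤-Reasoning

          -- On the same level the j-exponent drops by one. This fails to stay beside the path only
          -- if the result is a node, which is impossible inside `I`.
          j⇒c : Beside (X j · b) → Beside (X c · b)
          j⇒c p with find p
          ... | w , w∈ , wa , wj with lookup w j <? lookup b j
          ...   | yes lt = lose w∈ (trans wa (trans Xj-a (sym Xc-a)) , ≤-trans lt (≤-reflexive (sym Xc-j)))
          ...   | no ≮   = contradiction (member-∣ b∈I (∣-X c b)) (subst (λ v → ¬ ⟨ I ⟩ v) w≡ (proj₂ (outside w∈)))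
            where
            w≡ : w ≡ X c · b
            w≡ = same-monomial (trans (proj₁ (outside w∈)) (sym (trans (deg-X c b) degb))) (trans wa (trans Xj-a (sym Xc-a)))
              (trans (≤-antisym (s≤s⁻¹ (≤-trans wj (≤-reflexive (X-same j b)))) (≮⇒≥ ≮)) (sym Xc-j))

          c⇒a : Beside (X c · b) → Beside (X a · b)
          c⇒a p with find p
          ... | w , w∈ , wa , wj with up w∈ (≤-trans (≤-reflexive (cong suc (trans wa Xc-a))) ba<)
          ...   | v , v∈ , va , vj = lose v∈ (trans va (trans (cong suc (trans wa Xc-a)) (sym Xa-a)) ,
                    ≤-trans (s≤s vj) (≤-trans wj (≤-reflexive (trans Xc-j (sym Xa-j)))))

        -- The three implications form a cycle: the path cannot separate the neighbours of a
        -- downward-pointing triangle inside `I`.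
        beside-X : ∀ i i′ → Beside (X i · b) → Beside (X i′ · b)
        beside-X i i′ p = from-c (to-c p)
          where
          to-c : Beside (X i · b) → Beside (X c · b)
          to-c p with every i
          ... | inj₁ refl        = j⇒c (a⇒j p)
          ... | inj₂ (inj₁ refl) = j⇒c p
          ... | inj₂ (inj₂ refl) = p
          from-c : Beside (X c · b) → Beside (X i′ · b)
          from-c p with every i′
          ... | inj₁ refl        = c⇒a p
          ... | inj₂ (inj₁ refl) = a⇒j (c⇒a p)
          ... | inj₂ (inj₂ refl) = p

  -- The two chains starting at a tile that points in the direction of j cut the triangle into the part
  -- around the corner j ^ n and the part containing the other two corners.
  module Cut {a j c : Fin 3} (coords : Coordinates a j c) {b₀ : Monomial} (tile₀ : Tile b₀ (X j · b₀)) where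

    open Coordinates coords

    u₀ : Monomial
    u₀ = X j · b₀

    module A = Direction coords
    module C = Direction (reverse coords)

    module AB = A.Beside (A.chain _ refl (b₀ , j , ≢-sym a≢j , refl , tile₀))
    module CB = C.Beside (C.chain _ refl (b₀ , j , j≢c , refl , tile₀))

    Near : Monomial → Set
    Near v = AB.Beside v ⊎ CB.Beside v

    near? : Decidable Near
    near? v = AB.beside? v ⊎-dec CB.beside? v

    near-corner : ∀ {v} → deg v ≡ n → ⟨ I ⟩ v → lookup v a ≡ 0 → lookup v c ≡ 0 → Near v
    near-corner degv v∈I va vc = inj₁ (AB.beside-corner degv v∈I (≤-trans (≤-reflexive va) z≤n) (≤-trans (≤-reflexive vc) z≤n))

    far-corner : ∀ {v} → lookup v j ≡ 0 → ¬ Near v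
    far-corner {v} vj (inj₁ p) = contradiction (≤-trans (proj₂ (AB.beside-bounds v p)) (≤-reflexive vj)) λ ()
    far-corner {v} vj (inj₂ p) = contradiction (≤-trans (proj₂ (CB.beside-bounds v p)) (≤-reflexive vj)) λ ()

    near-X : ∀ {b} → suc (deg b) ≡ n → ⟨ I ⟩ b → ∀ i i′ → Near (X i · b) → Near (X i′ · b)
    near-X {b} degb b∈I i i′ near with lookup b a <? lookup u₀ a | lookup b c <? lookup u₀ c
    ... | yes ba< | yes bc< = [ inj₁ ∘ AB.beside-X degb b∈I ba< i i′ , inj₂ ∘ CB.beside-X degb b∈I bc< i i′ ]′ near
    -- A neighbour beside the second path has a- and c-exponents at most those of `u₀`, so by
    -- `beside-corner` it is beside the first path too.
    ... | yes ba< | no _    = inj₁ (AB.beside-X degb b∈I ba< i i′ ([ id , (λ q →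
            AB.beside-corner (trans (deg-X i b) degb) (member-∣ b∈I (∣-X i b))
              (≤-trans (X-lookup-≤ i a b) ba<) (proj₁ (CB.beside-bounds (X i · b) q))) ]′ near))
    ... | no _    | yes bc< = inj₂ (CB.beside-X degb b∈I bc< i i′ ([ (λ p →
            CB.beside-corner (trans (deg-X i b) degb) (member-∣ b∈I (∣-X i b))
              (≤-trans (X-lookup-≤ i c b) bc<) (proj₁ (AB.beside-bounds (X i · b) p))) , id ]′ near))
    -- Then `b` would have all exponents at least those of `u₀`, although its degree is smaller.
    ... | no ≮a   | no ≮c   = contradiction (begin
      suc (deg b)                                           ≡⟨ degb ⟩
      n                                                     ≡⟨ proj₁ (Tile-up tile₀) ⟨
      deg u₀                                                ≡⟨ deg≡ u₀ ⟩
      lookup u₀ a + lookup u₀ j + lookup u₀ c               ≤⟨ +-mono-≤ (+-mono-≤ (≮⇒≥ ≮a) u₀j≤) (≮⇒≥ ≮c) ⟩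
      lookup b a + lookup b j + lookup b c                  ≡⟨ deg≡ b ⟨
      deg b                                                 ∎) (<-irrefl refl)
      where
      open ≤-Reasoning
      u₀j≤ : lookup u₀ j ≤ lookup b j
      u₀j≤ = s≤s⁻¹ (≤-trans ([ proj₂ ∘ AB.beside-bounds (X i · b) , proj₂ ∘ CB.beside-bounds (X i · b) ]′ near) (X-lookup-≤ i j b))

-- Overpunctured tilings

∸-superadditive : ∀ x y o → (x ∸ o) + (y ∸ o) ≤ (x + y) ∸ o
∸-superadditive x y o with o ≤? x
... | yes o≤x = ≤-trans (+-monoʳ-≤ (x ∸ o) (m∸n≤m y o)) (≤-reflexive (sym (+-∸-comm y o≤x)))
... | no o≰x  = ≤-trans (≤-reflexive (cong (_+ (y ∸ o)) (m≤n⇒m∸n≡0 (<⇒≤ (≰⇒> o≰x))))) (∸-monoˡ-≤ o (m≤n+m y x))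

-- A whole family weighs at most as much as one triangle of its total side.
Σ-∸-≤ : (xs : List A) (f : A → ℕ) (M o : ℕ) → Σ xs (λ x → f x * M ∸ o) ≤ Σ xs f * M ∸ o
Σ-∸-≤ []       f M o = z≤n
Σ-∸-≤ (x ∷ xs) f M o = ≤-trans (+-monoʳ-≤ (f x * M ∸ o) (Σ-∸-≤ xs f M o))
  (≤-trans (∸-superadditive (f x * M) (Σ xs f * M) o) (≤-reflexive (cong (_∸ o) (sym (*-distribʳ-+ M (f x) (Σ xs f))))))

-- If neither difference is truncated, o is subtracted twice and restored once. If one is, the other
-- side is less than D; if both are, only o remains.
∸-superadditive-< : ∀ {D M o a b} .{{_ : NonZero M}} → 0 < o → o < D * M → 0 < a → 0 < b → a + b ≤ D →
  (a * M ∸ o) + (b * M ∸ o) + o < D * M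
∸-superadditive-< {D} {M} {o} {a} {b} 0<o o< 0<a 0<b a+b≤ with a * M ≤? o | b * M ≤? o
... | yes aM≤o | yes bM≤o = ≤-trans (s≤s (≤-reflexive (cong₂ (λ p q → p + q + o) (m≤n⇒m∸n≡0 aM≤o) (m≤n⇒m∸n≡0 bM≤o)))) o<
... | yes aM≤o | no bM≰o  = ≤-trans (s≤s (≤-reflexive (trans (cong (λ p → p + (b * M ∸ o) + o) (m≤n⇒m∸n≡0 aM≤o))
                                (m∸n+n≡m (<⇒≤ (≰⇒> bM≰o))))))
                              (*-monoˡ-< M (≤-trans (+-monoˡ-≤ b 0<a) a+b≤))
... | no aM≰o  | yes bM≤o = ≤-trans (s≤s (≤-reflexive (trans (cong (λ q → (a * M ∸ o) + q + o) (m≤n⇒m∸n≡0 bM≤o))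
                                (trans (cong (_+ o) (+-identityʳ _)) (m∸n+n≡m (<⇒≤ (≰⇒> aM≰o)))))))
                              (*-monoˡ-< M (≤-trans (≤-trans (≤-reflexive (+-comm 1 a)) (+-monoʳ-≤ a 0<b)) a+b≤))
... | no aM≰o  | no bM≰o  = begin-strict
  (a * M ∸ o) + (b * M ∸ o) + o   ≡⟨ +-assoc (a * M ∸ o) _ o ⟩
  (a * M ∸ o) + (b * M ∸ o + o)   ≡⟨ cong (_+_ (a * M ∸ o)) (m∸n+n≡m (<⇒≤ (≰⇒> bM≰o))) ⟩
  (a * M ∸ o) + b * M             <⟨ +-monoˡ-< (b * M) (∸-monoʳ-< 0<o (<⇒≤ (≰⇒> aM≰o))) ⟩
  a * M + b * M                   ≡⟨ *-distribʳ-+ M a b ⟨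
  (a + b) * M                     ≤⟨ *-monoˡ-≤ M a+b≤ ⟩
  D * M                           ∎
  where open ≤-Reasoning

∣-step : ∀ {g u} → g ∣ u → g ≡ u ⊎ (∃ λ i → X i · g ∣ u)
∣-step {x ∷ y ∷ z ∷ []} {x′ ∷ y′ ∷ z′ ∷ []} (p ∷ q ∷ r ∷ [])
  with m≤n⇒m<n∨m≡n p | m≤n⇒m<n∨m≡n q | m≤n⇒m<n∨m≡n r
... | inj₁ p<       | _              | _              = inj₂ (0F , p< ∷ q ∷ r ∷ [])
... | inj₂ refl     | inj₁ q<        | _              = inj₂ (1F , p ∷ q< ∷ r ∷ [])
... | inj₂ refl     | inj₂ refl      | inj₁ r<        = inj₂ (2F , p ∷ q ∷ r< ∷ [])
... | inj₂ refl     | inj₂ refl      | inj₂ refl      = inj₁ refl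

∣-deg≡ : ∀ {g u} → g ∣ u → deg g ≡ deg u → g ≡ u
∣-deg≡ {g} g∣u eq with ∣-step g∣u
... | inj₁ g≡u         = g≡u
... | inj₂ (i , Xg∣u) = contradiction (≤-trans (≤-reflexive (sym (deg-X i g))) (≤-trans (deg-mono Xg∣u) (≤-reflexive (sym eq)))) (<-irrefl refl)

X-mono : ∀ i {u v} → u ∣ v → X i · u ∣ X i · v
X-mono 0F (p ∷ q ∷ r ∷ []) = s≤s p ∷ q ∷ r ∷ []
X-mono 1F (p ∷ q ∷ r ∷ []) = p ∷ s≤s q ∷ r ∷ []
X-mono 2F (p ∷ q ∷ r ∷ []) = p ∷ q ∷ s≤s r ∷ []

multiple-of-degree : ∀ k g → ∃ λ u → deg u ≡ deg g + k × g ∣ u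
multiple-of-degree zero    g = g , sym (+-identityʳ _) , ∣-refl
multiple-of-degree (suc k) g with multiple-of-degree k g
... | u , degu , g∣u = X 0F · u , trans (deg-X 0F u) (trans (cong suc degu) (sym (+-suc (deg g) k))) , ∣-trans g∣u (∣-X 0F u)

power : Fin 3 → ℕ → Monomial
power i n = updateAt 𝟏 i (λ _ → n)

deg-power : ∀ i n → deg (power i n) ≡ n
deg-power 0F n = +-identityʳ n
deg-power 1F n = +-identityʳ n
deg-power 2F n = +-identityʳ n

lookup-power : ∀ {i k} n → k ≢ i → lookup (power i n) k ≡ 0
lookup-power {0F} {0F} n k≢i = contradiction refl k≢i
lookup-power {0F} {1F} n k≢i = refl
lookup-power {0F} {2F} n k≢i = refl
lookup-power {1F} {0F} n k≢i = refl
lookup-power {1F} {1F} n k≢i = contradiction refl k≢i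
lookup-power {1F} {2F} n k≢i = refl
lookup-power {2F} {0F} n k≢i = refl
lookup-power {2F} {1F} n k≢i = refl
lookup-power {2F} {2F} n k≢i = contradiction refl k≢i

∣-power : ∀ i {g N n} → g ∣ power i N → deg g ≤ n → g ∣ power i n
∣-power 0F {x ∷ y ∷ z ∷ []} (_ ∷ q ∷ r ∷ []) le = ≤-trans (m≤m+n x _) le ∷ q ∷ r ∷ []
∣-power 1F {x ∷ y ∷ z ∷ []} (p ∷ _ ∷ r ∷ []) le = p ∷ ≤-trans (≤-trans (m≤m+n y _) (m≤n+m _ x)) le ∷ r ∷ []
∣-power 2F {x ∷ y ∷ z ∷ []} (p ∷ q ∷ _ ∷ []) le =
  p ∷ q ∷ ≤-trans (≤-trans (≤-trans (m≤m+n z 0) (m≤n+m _ y)) (m≤n+m _ x)) le ∷ []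

∣-powers⇒𝟏 : ∀ {g N N′} → g ∣ power 0F N → g ∣ power 1F N′ → g ≡ 𝟏
∣-powers⇒𝟏 (_ ∷ z≤n ∷ z≤n ∷ []) (z≤n ∷ _) = refl

module Overpunctured (I : MonomialIdeal) (n : ℕ) (bound : ∀ i → deg (gen I i) ≤ suc n)
  (ss : SyzygyBundleSemistable I) (2≤m : 2 ≤ m I) (coprime : ∀ {h} → (∀ i → h ∣ gen I i) → deg h ≡ 0)
  (non-unit : ∀ i → 1 ≤ deg (gen I i)) (powers : ∀ i → ∃₂ λ k N → gen I k ∣ power i N)
  (ℓs : List Lozenge) (partition : IsPartition (T (suc n) I) ℓs)
  (o : ℕ) (0<o : 0 < o) (sides≡ : Punctured.sides I n bound ≡ suc n + o) where

  open Punctured I n bound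
  open Tilings I n bound
  open Tiling ℓs partition
  open Separation I n bound ℓs partition
  open Semistable ss 2≤m coprime o sides≡

  private
    instance
      M-nonZero : NonZero M
      M-nonZero = >-nonZero (m<n⇒0<n∸m 2≤m)

  -- No generator is a unit, so each of the M + 1 sides is at most n.
  o< : o < suc n * M
  o< = +-cancelˡ-≤ n _ _ (begin
    n + suc o                   ≡⟨ trans (+-suc n o) (sym sides≡) ⟩
    sides                       ≤⟨ Σ-mono indices (λ {i} _ → ∸-monoʳ-≤ (suc n) (non-unit i)) ⟩
    Σ indices (λ _ → n)         ≡⟨ trans (Σ-const indices n) (cong (_* n) (trans length-indices m≡1+M)) ⟩
    n + M * n                   ≤⟨ +-monoʳ-≤ n (≤-trans (≤-reflexive (*-comm M n)) (*-monoˡ-≤ M (n≤1+n n))) ⟩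
    n + suc n * M               ∎)
    where open ≤-Reasoning

  -- A side 0 would gain an extra o in the lower bound for the weights, whereas sweeping `△Inside`
  -- bounds them by (n + 1) M - o.
  sides-positive : ∀ i → 1 ≤ side i
  sides-positive i with 1 ≤? side i
  ... | yes 1≤ = 1≤
  ... | no 1≰ with sweep n △Inside (AllPairs.filter⁺ member? (monomials-sorted n))
                     (All.tabulate (λ w∈ → ∈-monomials⁻ n (proj₁ (∈-filter⁻ member? w∈))))
                     (Unique.filter⁺ member? (monomials⁻-unique n)) X-∈-inside
  ...   | H , fam , covers , le = contradiction (begin-strict
    suc n * M                              ≤⟨ weights-≥′ (n≤0⇒n≡0 (s≤s⁻¹ (≰⇒> 1≰))) ⟩
    Σ indices weight                       ≤⟨ weights-≤ H (generators-covered fam covers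
                                                (λ g∣u degu → ∈-filter⁺ member? (∈-monomials⁺ degu) (_ , g∣u))) ⟩
    Σ H (λ h → size n h * M ∸ o)           ≤⟨ Σ-∸-≤ H (size n) M o ⟩
    Σ H (size n) * M ∸ o                   ≤⟨ ∸-monoˡ-≤ o (*-monoˡ-≤ M (+-cancelˡ-≤ (length ▽Inside) _ _
                                                (≤-trans (≤-reflexive (+-comm (length ▽Inside) _)) (≤-trans le (≤-reflexive △Inside≡))))) ⟩
    suc n * M ∸ o                          <⟨ ∸-monoʳ-< 0<o (<⇒≤ o<) ⟩
    suc n * M                              ∎) (<-irrefl refl)
    where open ≤-Reasoning

  corner∈ : ∀ i → ⟨ I ⟩ (power i n)
  corner∈ i with powers i
  ... | k , N , g∣ = k , ∣-power i g∣ (s≤s⁻¹ (m∸n≢0⇒n<m {suc n} {deg (gen I k)} (≢-sym (<⇒≢ (sides-positive k)))))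

  -- A property shared by neighbours inside `I` is constant on each puncture. Induction on the side:
  -- it is constant on the three corner subtriangles, and these are linked pairwise.
  monochromatic : (P : Monomial → Set) → (∀ {b} → suc (deg b) ≡ n → ⟨ I ⟩ b → ∀ i i′ → P (X i · b) → P (X i′ · b)) →
    ∀ k g → deg g + k ≡ n → ⟨ I ⟩ g → ∀ {u v} → deg u ≡ n → deg v ≡ n → g ∣ u → g ∣ v → P u → P v
  monochromatic P PX zero g eq g∈ {u} {v} degu degv g∣u g∣v Pu =
    subst P (trans (sym (∣-deg≡ g∣u (g≡ {u} degu))) (∣-deg≡ g∣v (g≡ {v} degv))) Pu
    where
    g≡ : ∀ {w} → deg w ≡ n → deg g ≡ deg w
    g≡ degw = trans (sym (+-identityʳ _)) (trans eq (sym degw))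
  monochromatic P PX (suc k) g eq g∈ {u} {v} degu degv g∣u g∣v Pu with ∣-step g∣u | ∣-step g∣v
  ... | inj₁ refl | _ = contradiction (trans degu (sym eq)) (<⇒≢ (m<m+n (deg g) (s≤s z≤n)))
  ... | inj₂ _    | inj₁ refl = contradiction (trans degv (sym eq)) (<⇒≢ (m<m+n (deg g) (s≤s z≤n)))
  ... | inj₂ (i , Xg∣u) | inj₂ (i′ , Xg∣v) = connect k eq
    where
    deg-Xg : ∀ i {k} → deg g + suc k ≡ n → deg (X i · g) + k ≡ n
    deg-Xg i {k} eq = trans (cong (_+ k) (deg-X i g)) (trans (sym (+-suc (deg g) k)) eq)
    recurse : ∀ i {t w} → deg t ≡ n → deg w ≡ n → X i · g ∣ t → X i · g ∣ w → P t → P w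
    recurse i = monochromatic P PX k (X i · g) (deg-Xg i eq) (member-∣ g∈ (∣-X i g))
    connect : ∀ k → deg g + suc k ≡ n → P v
    -- The subtriangles are single unit triangles, namely neighbours of the downward-pointing
    -- triangle `g`.
    connect zero eq = subst P (∣-deg≡ Xg∣v (X≡ i′ {v} degv)) (PX (trans (+-comm 1 _) eq) g∈ i i′
      (subst P (sym (∣-deg≡ Xg∣u (X≡ i {u} degu))) Pu))
      where
      X≡ : ∀ i {w} → deg w ≡ n → deg (X i · g) ≡ deg w
      X≡ i degw = trans (sym (+-identityʳ _)) (trans (deg-Xg i eq) (sym degw))
    -- Larger subtriangles overlap, and `t` lies in both.
    connect (suc k) eq with multiple-of-degree k (X i · X i′ · g)
    ... | t , degt , XX∣t = recurse i′ degt′ degv (∣-trans (∣-X i (X i′ · g)) XX∣t) Xg∣v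
        (recurse i degu degt′ Xg∣u (∣-trans (X-mono i (∣-X i′ g)) XX∣t) Pu)
      where
      degt′ : deg t ≡ n
      degt′ = trans degt (trans (cong (_+ k) (trans (deg-X i (X i′ · g)) (cong suc (deg-X i′ g))))
        (trans (cong suc (sym (+-suc (deg g) k))) (trans (sym (+-suc (deg g) (suc k))) eq)))

  -- The two parts of a cut are swept separately.  Both are non-empty, so the two families together
  -- give one term o too many in the weight bound.
  module _ {a j c : Fin 3} (coords : Coordinates a j c) {b₀ : Monomial} (tile₀ : Tile b₀ (X j · b₀)) where

    private
      open Cut coords tile₀
      far? : Decidable (¬_ ∘ Near)
      far? = ¬? ∘ near?
      near▽? : Decidable (Near ∘ (X 0F ·_))
      near▽? = near? ∘ (X 0F ·_)
      far▽? : Decidable (¬_ ∘ Near ∘ (X 0F ·_))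
      far▽? = ¬? ∘ near▽?

      ▽Inside⁻ : ∀ {b} → b ∈ ▽Inside → suc (deg b) ≡ n × ⟨ I ⟩ b
      ▽Inside⁻ b∈ with ∈-filter⁻ member? {xs = monomials⁻ n} b∈
      ... | b∈L , b∈I = ∈-monomials⁻⁻ n b∈L , b∈I

      -- A downward-pointing triangle is assigned to the part of its neighbour x b. As all its
      -- neighbours are in that part, the sweep applies to each part alone.
      sweepPart : {P : Monomial → Set} (P? : Decidable P) →
        (∀ {b} → b ∈ ▽Inside → P (X 0F · b) → ∀ i → P (X i · b)) →
        ∃ λ H → Family n H × Covers H (filter P? △Inside) ×
          Σ H (size n) + length (filter (P? ∘ (X 0F ·_)) ▽Inside) ≤ length (filter P? △Inside)
      sweepPart P? PX = sweep n (filter P? △Inside)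
        (AllPairs.filter⁺ P? (AllPairs.filter⁺ member? (monomials-sorted n)))
        (All.tabulate (λ w∈ → ∈-monomials⁻ n (proj₁ (∈-filter⁻ member? (proj₁ (∈-filter⁻ P? {xs = △Inside} w∈))))))
        (Unique.filter⁺ (P? ∘ (X 0F ·_)) (Unique.filter⁺ member? (monomials⁻-unique n)))
        (λ b∈ i → let b∈In , Pb = ∈-filter⁻ (P? ∘ (X 0F ·_)) {xs = ▽Inside} b∈
          in ∈-filter⁺ P? (X-∈-inside b∈In i) (PX b∈In Pb i))

      non-empty : ∀ {H} {P : Monomial → Set} {P? : Decidable P} → Family n H → Covers H (filter P? △Inside) →
        ∀ {u} → deg u ≡ n → ⟨ I ⟩ u → P u → 0 < Σ H (size n)
      non-empty {H} {P? = P?} fam covers degu u∈I Pu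
        with covers (∈-filter⁺ P? (∈-filter⁺ member? (∈-monomials⁺ degu) u∈I) Pu)
      ... | h , h∈ , _ = ≤-trans (m<n⇒0<n∸m (s≤s (All.lookup (Family.nonzero fam) h∈))) (Σ-≥ H (size n) h∈)

      near-X′ : ∀ {b} → b ∈ ▽Inside → ∀ i i′ → Near (X i · b) → Near (X i′ · b)
      near-X′ b∈ = near-X (proj₁ (▽Inside⁻ b∈)) (proj₂ (▽Inside⁻ b∈))

    no-cut : ⊥
    no-cut with sweepPart near? (λ b∈ near i → near-X′ b∈ 0F i near)
              | sweepPart far? (λ b∈ far i near → far (near-X′ b∈ i 0F near))
    ... | H₁ , fam₁ , covers₁ , le₁ | H₂ , fam₂ , covers₂ , le₂ = <-irrefl refl (begin-strict
      suc n * M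
        ≤⟨ weights-≥ ⟩
      Σ indices weight + o
        ≤⟨ +-monoˡ-≤ o (weights-≤ (H₁ ++ H₂) (λ i _ → covered i)) ⟩
      Σ (H₁ ++ H₂) (λ h → size n h * M ∸ o) + o
        ≡⟨ cong (_+ o) (Σ-++ H₁ H₂ _) ⟩
      Σ H₁ (λ h → size n h * M ∸ o) + Σ H₂ (λ h → size n h * M ∸ o) + o
        ≤⟨ +-monoˡ-≤ o (+-mono-≤ (Σ-∸-≤ H₁ (size n) M o) (Σ-∸-≤ H₂ (size n) M o)) ⟩
      (Σ H₁ (size n) * M ∸ o) + (Σ H₂ (size n) * M ∸ o) + o
        <⟨ ∸-superadditive-< 0<o o<
             -- The corner of `j` is near and the corner of `a` is far, so both total sides are
             -- positive.
             (non-empty {P? = near?} fam₁ covers₁ (deg-power j n) (corner∈ j)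
               (near-corner (deg-power j n) (corner∈ j) (lookup-power n a≢j) (lookup-power n (≢-sym j≢c))))
             (non-empty {P? = far?} fam₂ covers₂ (deg-power a n) (corner∈ a)
               (far-corner {power a n} (lookup-power n (≢-sym a≢j))))
             total ⟩
      suc n * M ∎)
      where
      open ≤-Reasoning
      open Coordinates coords
      total : Σ H₁ (size n) + Σ H₂ (size n) ≤ suc n
      total = +-cancelʳ-≤ (length ▽Inside) _ _ (begin
        Σ H₁ (size n) + Σ H₂ (size n) + length ▽Inside
          ≡⟨ cong (_+_ (Σ H₁ (size n) + Σ H₂ (size n))) (length-filter-¬ near▽? ▽Inside) ⟨
        Σ H₁ (size n) + Σ H₂ (size n) + (length (filter near▽? ▽Inside) + length (filter far▽? ▽Inside))
          ≡⟨ interchange (Σ H₁ (size n)) (Σ H₂ (size n)) _ _ ⟩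
        Σ H₁ (size n) + length (filter near▽? ▽Inside) + (Σ H₂ (size n) + length (filter far▽? ▽Inside))
          ≤⟨ +-mono-≤ le₁ le₂ ⟩
        length (filter near? △Inside) + length (filter far? △Inside)
          ≡⟨ length-filter-¬ near? △Inside ⟩
        length △Inside
          ≡⟨ trans △Inside≡ (+-comm (length ▽Inside) (suc n)) ⟩
        suc n + length ▽Inside ∎)
        where
        interchange : ∀ a b c d → a + b + (c + d) ≡ a + c + (b + d)
        interchange = solve-∀
      -- By `monochromatic` each puncture lies in one part, which any of its unit triangles `u`
      -- decides.
      covered : ∀ i → ∃ λ h → h ∈ H₁ ++ H₂ × h ∣ gen I i
      covered i with multiple-of-degree (n ∸ deg (gen I i)) (gen I i)
      ... | u , degu , g∣u = by-colour (near? u)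
        where
        g = gen I i
        eq : deg g + (n ∸ deg g) ≡ n
        eq = m+[n∸m]≡n (s≤s⁻¹ (m∸n≢0⇒n<m {suc n} {deg g} (≢-sym (<⇒≢ (sides-positive i)))))
        same : ∀ {v w} → deg v ≡ n → deg w ≡ n → g ∣ v → g ∣ w → Near v → Near w
        same = monochromatic Near near-X (n ∸ deg g) g eq (i , ∣-refl)
        inside : ∀ {v} → deg v ≡ n → g ∣ v → v ∈ △Inside
        inside degv g∣v = ∈-filter⁺ member? (∈-monomials⁺ degv) (i , g∣v)
        by-colour : Dec (Near u) → ∃ λ h → h ∈ H₁ ++ H₂ × h ∣ g
        by-colour (yes near) with covers-divisor fam₁ covers₁ (n ∸ deg g) g eq
          (λ degv g∣v → ∈-filter⁺ near? (inside degv g∣v) (same (trans degu eq) degv g∣u g∣v near))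
        ... | h , h∈ , h∣ = h , ∈-++⁺ˡ h∈ , h∣
        by-colour (no far) with covers-divisor fam₂ covers₂ (n ∸ deg g) g eq
          (λ degv g∣v → ∈-filter⁺ far? (inside degv g∣v) (λ near → far (same degv (trans degu eq) g∣v g∣u near)))
        ... | h , h∈ , h∣ = h , ∈-++⁺ʳ H₁ h∈ , h∣

  no-tile : ∀ {j b₀} → ¬ Tile b₀ (X j · b₀)
  no-tile {j} tile₀ with coordinates j
  ... | _ , _ , coords = no-cut coords tile₀

-- The theorem

-- The exponent `N` exceeds the degree of every listed monomial, so this power cannot lie outside
-- the ideal.
power∈ : ∀ I → Artinian I → ∀ i → ∃₂ λ k N → gen I k ∣ power i N
power∈ I (ns , outside⊆) i with Fin.any? (λ k → gen I k ∣? power i N)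
  where
  N : ℕ
  N = suc (Σ ns deg)
... | yes (k , g∣) = k , _ , g∣
... | no  ∉I       = contradiction (≤-trans (≤-reflexive (sym (deg-power i _))) (Σ-≥ ns deg (outside⊆ ∉I))) (<-irrefl refl)

module NonEmpty (n : ℕ) (I : MonomialIdeal) (artinian : Artinian I) (bound : ∀ i → deg (gen I i) ≤ suc n)
  (satisfiable : Satisfiable (T (suc n) I)) where

  open Punctured I n bound

  powers : ∀ i → ∃₂ λ k N → gen I k ∣ power i N
  powers = power∈ I artinian

  generator≢𝟏 : ∀ i → gen I i ≢ 𝟏
  generator≢𝟏 i g≡𝟏 = proj₂ (proj₂ satisfiable) (i , subst (_∣ label (proj₁ satisfiable)) (sym g≡𝟏) (𝟏∣ _))

  non-unit : ∀ i → 1 ≤ deg (gen I i)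
  non-unit i = n≢0⇒n>0 (λ deg≡0 → generator≢𝟏 i (sym (∣-deg≡ (𝟏∣ (gen I i)) (sym deg≡0))))

  coprime : ∀ {h} → (∀ i → h ∣ gen I i) → deg h ≡ 0
  coprime h∣ with powers 0F | powers 1F
  ... | k , _ , g∣ | k′ , _ , g′∣ = cong deg (∣-powers⇒𝟏 (∣-trans (h∣ k) g∣) (∣-trans (h∣ k′) g′∣))

  -- A generator dividing both a power of x and a power of y would be 1, which would make `T` empty.
  2≤m : 2 ≤ m I
  2≤m with powers 0F | powers 1F
  ... | k , _ , g∣ | k′ , _ , g′∣ = two k k′ (λ { refl → generator≢𝟏 k (∣-powers⇒𝟏 g∣ g′∣) })
    where
    two : ∀ {m} (k k′ : Fin m) → k ≢ k′ → 2 ≤ m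
    two {suc zero}    0F 0F k≢k′ = contradiction refl k≢k′
    two {suc (suc m)} _  _  _    = s≤s (s≤s z≤n)

  tiling : Tileable (T (suc n) I) → ∃ (IsPartition (T (suc n) I))
  tiling (inj₁ empty)  = contradiction (proj₂ satisfiable) (empty (proj₁ satisfiable))
  tiling (inj₂ tiling) = tiling

  perfectlyPunctured : Tileable (T (suc n) I) → SyzygyBundleSemistable I → sides ≡ suc n
  perfectlyPunctured tileable ss with tiling tileable
  ... | ℓs , partition with sides ∸ suc n in o≡
  ...   | zero  = ≤-antisym (m∸n≡0⇒m≤n o≡) n≤
    where
    open Tilings I n bound
    open Tiling ℓs partition
    n≤ : suc n ≤ sides
    n≤ = +-cancelʳ-≤ (Σ (monomials n) excess) _ _ (≤-trans (≤-reflexive excess≡) (+-monoʳ-≤ sides excess-≤))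
  -- The given unit triangle of `T` lies in a lozenge, from which the impossible cut starts.
  ...   | suc o = contradiction (a-tile satisfiable) λ { (_ , _ , tile) → no-tile tile }
    where
    open Tilings I n bound
    open Tiling ℓs partition
    sides≡ : sides ≡ suc n + suc o
    sides≡ = trans (sym (m+[n∸m]≡n (<⇒≤ (m∸n≢0⇒n<m {sides} {suc n} (λ eq → 0≢1+n (trans (sym eq) o≡)))))) (cong (_+_ (suc n)) o≡)
    open Overpunctured I n bound ss 2≤m coprime non-unit powers ℓs partition (suc o) (s≤s z≤n) sides≡
    a-tile : Satisfiable (T (suc n) I) → ∃₂ λ b j → Tile b (X j · b)
    a-tile (▽ b , degb , b∉) with tile-of-▽ (suc-injective degb) b∉
    ... | j , tile = b , j , tile
    a-tile (△ u , degu , u∉) with tile-of-△ (suc-injective degu) u∉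
    ... | b , j , refl , tile = b , j , tile

theorem4p5 : (d : ℕ) → 1 ≤ d → (I : MonomialIdeal) → Artinian I →
    (∀ i → deg (gen I i) ≤ d) →
    Satisfiable (T d I) →
      (PerfectlyPunctured d I × Tileable (T d I) → SyzygyBundleSemistable I)
    × (PerfectlyPunctured d I × SyzygyBundleSemistable I → Tileable (T d I))
    × (Tileable (T d I) × SyzygyBundleSemistable I → PerfectlyPunctured d I)
theorem4p5 (suc n) _ I artinian bound satisfiable =
    (λ { (pp , tileable) → Tilings.Tiling.semistable I n bound _ (proj₂ (tiling tileable)) (perfectlyPunctured⇒ pp) })
  , (λ { (pp , ss) → SemistableTilings.Balanced.tileable I n bound ss 2≤m coprime (perfectlyPunctured⇒ pp) })
  , (λ { (tileable , ss) → perfectlyPunctured⇐ (perfectlyPunctured tileable ss) })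
  where
  open Punctured I n bound
  open NonEmpty n I artinian bound satisfiable
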